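{- Let $p$ be an odd prime, $\mathcal O$ a complete discrete valuation ring with maximal ideal generated by $p$ and perfect residue field, $\delta$ its unique $p$-derivation, $n\ge1$, and let $q_1,\dots,q_n\in GL_n(\mathcal O)$, $q_i=(q_{ijk})_{j,k}$, be symmetric matrices. Let $(\delta_1^G,\dots,\delta_n^G)$ be the Levi-Civita connection on $G=GL_n$ over $\mathcal O$ attached to $(q_1,\dots,q_n)$, with Christoffel symbols $\Gamma_i=(\Gamma_{ijk})$. Let $$C_i=(C_{ijk})_{j,k}:=-x^{(p)t}\cdot\delta q_i\cdot x^{(p)}+\frac1p\left\{(x^tq_ix)^{(p)}-x^{(p)t}q_i^{(p)}x^{(p)}\right\}.$$ Then for all $i,j,k$ the following congruences hold in $\mathcal O(\widehat G)$: $$\Gamma_{ijk}\equiv\tfrac12(C_{ijk}+C_{jik}-C_{kij})\quad\text{mod }p,$$ $$\Gamma_{ijk}\equiv-\tfrac12(\delta q_{ijk}+\delta q_{jik}-\delta q_{kij})\quad\text{mod }(p,x-1),$$ where $(p,x-1)$ is the ideal generated by $p$, the $x_{ii}-1$, and the $x_{ij}$ for $i\neq j$.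
   Context: For a matrix $a=(a_{ij})$, $a^t$ is the transpose and $a^{(p)}=(a_{ij}^p)$; set maps between rings are applied to matrices entrywise. A Frobenius lift on a ring $A$ is a ring endomorphism reducing mod $p$ to the $p$-power Frobenius of $A/pA$. On a $p$-torsion free ring a $p$-derivation $\delta$ is the same as a Frobenius lift $\phi$, via $\phi(a)=a^p+p\,\delta a$ ("attached"). $\mathcal O$ has a unique Frobenius lift $\phi$, hence a unique $p$-derivation $\delta$. Let $x$ be an $n\times n$ matrix of indeterminates, $G=\mathrm{Spec}\,\mathcal O[x,\det(x)^{ -1}]$, $\mathcal O(\widehat G)$ the $p$-adic completion of $\mathcal O[x,\det(x)^{ -1}]$. A $p$-adic connection on $G$ is a $p$-derivation $\delta^G$ on $\mathcal O(\widehat G)$ extending $\delta$, with attached Frobenius lift $\phi^G$. It is metric with respect to a symmetric $q\in GL_n(\mathcal O)$ if $\phi^G\circ\mathcal H_q=\mathcal H_q\circ\phi_0^G$, where $\mathcal H_q$ is the (continuous) $\mathcal O$-algebra endomorphism of $\mathcal O(\widehat G)$ with $x\mapsto x^tqx$ and $\phi_0^G$ is the Frobenius lift extending $\phi$ with $\phi_0^G(x)=x^{(p)}$. The Christoffel symbols of an $n$-tuple $(\delta_1^G,\dots,\delta_n^G)$ with respect to $(q_1,\dots,q_n)$ are $\Gamma_i=(\Gamma_{ijk})_{j,k}:=(\delta_i^Gx)^t\cdot\phi(q_i)\cdot x^{(p)}$. The Levi-Civita connection attached to $(q_1,\dots,q_n)$ is the unique (it exists) $n$-tuple of $p$-adic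 connections such that $\delta_i^G$ is metric with respect to $q_i$ for all $i$ and $\Gamma_{ijk}=\Gamma_{jik}$ for all $i,j,k$. -}

module Defs where

open import Algebra.Bundles using (CommutativeRing; Semiring)
open import Algebra.Morphism.Structures using (module RingMorphisms)
open import Data.Bool.Base using (if_then_else_)
open import Data.Empty using (⊥-elim)
open import Data.Fin.Base as Fin using (Fin; zero; suc; toℕ; punchIn; combine)
import Data.Fin.Properties as Fin
open import Data.List.Base using (List; []; _∷_; _++_; map; length)
open import Data.Nat.Base as ℕ using (ℕ; zero; suc; z≤n; s≤s; _≤_; _<_; _∸_; _!)
import Data.Nat.Properties as ℕ
import Data.Nat.Divisibility as ℕ
import Data.Nat.DivMod as ℕ
open import Data.Nat.Combinatorics using (_C_; nCk≡n!/k![n-k]!; k![n∸k]!∣n!; nCn≡1)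
open import Data.Nat.Primality using (Prime; euclidsLemma; prime⇒nonZero; prime⇒nonTrivial)
open import Data.Product.Base using (Σ; ∃; ∃₂; _×_; _,_; proj₁; proj₂)
open import Data.Sum.Base using (_⊎_; inj₁; inj₂)
open import Data.Unit.Base using (⊤; tt)
open import Data.Vec.Base as Vec using (Vec; replicate; zipWith; tabulate)
import Data.Vec.Properties as Vec
open import Function.Base using (_∘_)
open import Function.Definitions using (Bijective)
open import Level using (Level; _⊔_)
open import Relation.Binary.PropositionalEquality as ≡ using (_≡_)
open import Relation.Nullary using (¬_; Dec; yes; no; does)

private variable
  a c ℓ c′ ℓ′ : Level

module Arith (R : CommutativeRing c ℓ) where
  open CommutativeRing R hiding (zero)
  open import Algebra.Definitions.RawSemiring (Semiring.rawSemiring semiring) public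
    using (_∣_; _^_; sum) renaming (_×_ to _•_)

  num : ℕ → Carrier
  num n = n • 1#

  infix 4 _≡_[mod_]
  _≡_[mod_] : Carrier → Carrier → Carrier → Set (c ⊔ ℓ)
  x ≡ y [mod d ] = d ∣ (x - y)

  data Ideal {I : Set a} (g : I → Carrier) : Carrier → Set (a ⊔ c ⊔ ℓ) where
    generator : ∀ i → Ideal g (g i)
    0∈        : Ideal g 0#
    +-closed  : ∀ {x y} → Ideal g x → Ideal g y → Ideal g (x + y)
    *-closed  : ∀ r {x} → Ideal g x → Ideal g (r * x)
    resp-≈    : ∀ {x y} → x ≈ y → Ideal g x → Ideal g y

  infix 4 _≡_[mod⟨_⟩]
  _≡_[mod⟨_⟩] : Carrier → Carrier → {I : Set a} → (I → Carrier) → Set _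
  x ≡ y [mod⟨ g ⟩] = Ideal g (x - y)

  Matrix : ℕ → Set c
  Matrix n = Fin n → Fin n → Carrier

  infixl 7 _·_
  _·_ : ∀ {n} → Matrix n → Matrix n → Matrix n
  (A · B) j k = sum (λ s → A j s * B s k)

  infixl 9 _ᵗ
  _ᵗ : ∀ {n} → Matrix n → Matrix n
  (A ᵗ) j k = A k j

  infixl 9 _⁽_⁾
  _⁽_⁾ : ∀ {n} → Matrix n → ℕ → Matrix n
  (A ⁽ p ⁾) j k = A j k ^ p

  𝟙 : ∀ {n} → Matrix n
  𝟙 j k = if does (j Fin.≟ k) then 1# else 0#

  -- Laplace expansion along the first row.
  det : ∀ {n} → Matrix n → Carrier
  det {zero}  A = 1#
  det {suc n} A =
    sum (λ s → (- 1#) ^ toℕ s * A zero s * det (λ j k → A (suc j) (punchIn s k)))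

  IsSymmetric : ∀ {n} → Matrix n → Set ℓ
  IsSymmetric A = ∀ j k → A j k ≈ A k j

  IsInvertible : ∀ {n} → Matrix n → Set (c ⊔ ℓ)
  IsInvertible {n} A =
    Σ (Matrix n) λ B → (∀ j k → (A · B) j k ≈ 𝟙 j k) × (∀ j k → (B · A) j k ≈ 𝟙 j k)

IsRingHom : (R : CommutativeRing c ℓ) (S : CommutativeRing c′ ℓ′) →
            (CommutativeRing.Carrier R → CommutativeRing.Carrier S) → Set _
IsRingHom R S = RingMorphisms.IsRingHomomorphism
                  (CommutativeRing.rawRing R) (CommutativeRing.rawRing S)

module ArithProperties (R : CommutativeRing c ℓ) where
  open CommutativeRing R hiding (zero)
  open Arith R
  open import Algebra.Definitions.RawMagma *-rawMagma public using (_,_)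
  open import Algebra.Properties.Ring ring public
  open import Algebra.Properties.AbelianGroup +-abelianGroup public
    using (⁻¹-∙-comm)
  open import Algebra.Properties.Semiring.Exp semiring public
    using (^-congˡ; ^-homo-*)
  open import Algebra.Properties.Semiring.Mult semiring public
    using (×-assoc-*; ×-assocˡ; ×-congʳ; ×1-homo-*)
  open import Algebra.Properties.Semiring.Sum semiring public
    using (sum-cong-≋; sum-init-last)
  open import Relation.Binary.Reasoning.Setoid setoid
  open import Algebra.Solver.Ring.NaturalCoefficients.Default commutativeSemiring
    using (solve; _:=_; _:+_; _:*_; con)

  quotient : ∀ {d x} → d ∣ x → Carrier
  quotient (q , _) = q

  quotient* : ∀ {d x} (h : d ∣ x) → quotient h * d ≈ x
  quotient* (_ , e) = e

  ∣-resp : ∀ {d x y} → x ≈ y → d ∣ x → d ∣ y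
  ∣-resp x≈y (q , e) = q , trans e x≈y

  ∣-+ : ∀ {d x y} → d ∣ x → d ∣ y → d ∣ (x + y)
  ∣-+ (q , e) (r , f) = q + r , trans (distribʳ _ _ _) (+-cong e f)

  ∣-* : ∀ {d} r {x} → d ∣ x → d ∣ (r * x)
  ∣-* r (q , e) = r * q , trans (*-assoc _ _ _) (*-congˡ e)

  ∣-neg : ∀ {d x} → d ∣ x → d ∣ (- x)
  ∣-neg (q , e) = - q , trans (sym (-‿distribˡ-* _ _)) (-‿cong e)

  ∣-0 : ∀ {d} → d ∣ 0#
  ∣-0 = 0# , zeroˡ _

  telescope : ∀ x y z → (x - y) + (y - z) ≈ x - z
  telescope x y z = begin
    (x - y) + (y - z)       ≈⟨ +-assoc _ _ _ ⟩
    x + (- y + (y - z))     ≈⟨ +-congˡ (sym (+-assoc _ _ _)) ⟩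
    x + ((- y + y) - z)     ≈⟨ +-congˡ (+-congʳ (-‿inverseˡ y)) ⟩
    x + (0# - z)            ≈⟨ +-congˡ (+-identityˡ _) ⟩
    x - z                   ∎

  interchange : ∀ x y z w → (x - y) + (z - w) ≈ (x + z) - (y + w)
  interchange x y z w = begin
    (x - y) + (z - w)       ≈⟨ solve 4 (λ x y z w → (x :+ y) :+ (z :+ w) := (x :+ z) :+ (y :+ w))
                                 refl x (- y) z (- w) ⟩
    (x + z) + (- y + - w)   ≈⟨ +-congˡ (⁻¹-∙-comm y w) ⟩
    (x + z) - (y + w)       ∎

  mod-reflexive : ∀ {d x y} → x ≈ y → x ≡ y [mod d ]
  mod-reflexive {x = x} {y} x≈y = ∣-resp (sym (x≈y⇒x∙y⁻¹≈ε x≈y)) ∣-0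

  mod-sym : ∀ {d x y} → x ≡ y [mod d ] → y ≡ x [mod d ]
  mod-sym {x = x} {y} h = ∣-resp (⁻¹-anti-homo-// x y) (∣-neg h)

  mod-trans : ∀ {d x y z} → x ≡ y [mod d ] → y ≡ z [mod d ] → x ≡ z [mod d ]
  mod-trans h k = ∣-resp (telescope _ _ _) (∣-+ h k)

  mod-+ : ∀ {d x y z w} → x ≡ y [mod d ] → z ≡ w [mod d ] → (x + z) ≡ (y + w) [mod d ]
  mod-+ h k = ∣-resp (interchange _ _ _ _) (∣-+ h k)

  mod-neg : ∀ {d x y} → x ≡ y [mod d ] → (- x) ≡ (- y) [mod d ]
  mod-neg {x = x} {y} h = ∣-resp (sym (⁻¹-∙-comm x (- y))) (∣-neg h)

  mod-*ˡ : ∀ {d} r {x y} → x ≡ y [mod d ] → (r * x) ≡ (r * y) [mod d ]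
  mod-*ˡ r h = ∣-resp (x[y-z]≈xy-xz r _ _) (∣-* r h)

  mod-* : ∀ {d x y z w} → x ≡ y [mod d ] → z ≡ w [mod d ] → (x * z) ≡ (y * w) [mod d ]
  mod-* {d} {x} {y} {z} {w} h k = mod-trans
    (mod-*ˡ x k)
    (mod-trans (mod-reflexive (*-comm x w))
      (mod-trans (mod-*ˡ w h) (mod-reflexive (*-comm w y))))

  mod-sum : ∀ {d n} {f g : Fin n → Carrier} →
            (∀ i → f i ≡ g i [mod d ]) → sum f ≡ sum g [mod d ]
  mod-sum {n = zero}  h = mod-reflexive refl
  mod-sum {n = suc n} h = mod-+ (h zero) (mod-sum (h ∘ suc))

-- R[x₁,…,xₘ]: finite formal sums of terms, identified when all coefficients
-- agree.
module Polynomial (R : CommutativeRing c ℓ) (m : ℕ) where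
  open CommutativeRing R hiding (zero)
  open ArithProperties R
  open import Relation.Binary.Reasoning.Setoid setoid
  open import Algebra.Solver.Ring.NaturalCoefficients.Default commutativeSemiring
    using (solve; _:=_; _:+_; _:*_; con)

  Monomial : Set
  Monomial = Vec ℕ m

  infixl 7 _∙_
  _∙_ : Monomial → Monomial → Monomial
  _∙_ = zipWith ℕ._+_

  ε : Monomial
  ε = replicate m 0

  _≟_ : (μ ν : Monomial) → Dec (μ ≡ ν)
  _≟_ = Vec.≡-dec ℕ._≟_

  Poly : Set c
  Poly = List (Carrier × Monomial)

  pair : (Monomial → Carrier) → Poly → Carrier
  pair h []            = 0#
  pair h ((a , ν) ∷ f) = a * h ν + pair h f

  indicator : Monomial → Monomial → Carrier
  indicator μ ν = if does (ν ≟ μ) then 1# else 0#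

  coeff : Monomial → Poly → Carrier
  coeff μ = pair (indicator μ)

  infix 4 _≋_
  record _≋_ (f g : Poly) : Set ℓ where
    constructor coeffwise
    field at : ∀ μ → coeff μ f ≈ coeff μ g
  open _≋_ public

  scale : Carrier × Monomial → Poly → Poly
  scale (a , ν) = map λ (b , μ) → a * b , ν ∙ μ

  infixl 7 _⊛_
  _⊛_ : Poly → Poly → Poly
  []      ⊛ g = []
  (t ∷ f) ⊛ g = scale t g ++ f ⊛ g

  neg : Poly → Poly
  neg = map λ (a , ν) → - a , ν

  const : Carrier → Poly
  const a = (a , ε) ∷ []

  var : Fin m → Poly
  var i = (1# , tabulate (λ j → if does (i Fin.≟ j) then 1 else 0)) ∷ []

  ∙-comm : ∀ μ ν → μ ∙ ν ≡ ν ∙ μ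
  ∙-comm = Vec.zipWith-comm ℕ.+-comm

  ∙-assoc : ∀ μ ν ρ → (μ ∙ ν) ∙ ρ ≡ μ ∙ (ν ∙ ρ)
  ∙-assoc = Vec.zipWith-assoc ℕ.+-assoc

  ∙-identityˡ : ∀ μ → ε ∙ μ ≡ μ
  ∙-identityˡ = Vec.zipWith-identityˡ ℕ.+-identityˡ

  pair-cong : ∀ {h k} → (∀ ν → h ν ≈ k ν) → ∀ f → pair h f ≈ pair k f
  pair-cong e []      = refl
  pair-cong e (t ∷ f) = +-cong (*-congˡ (e _)) (pair-cong e f)

  pair-++ : ∀ h f g → pair h (f ++ g) ≈ pair h f + pair h g
  pair-++ h []      g = sym (+-identityˡ _)
  pair-++ h (t ∷ f) g = trans (+-congˡ (pair-++ h f g)) (sym (+-assoc _ _ _))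

  pair-neg : ∀ h f → pair h (neg f) ≈ - pair h f
  pair-neg h []            = sym -0#≈0#
  pair-neg h ((a , ν) ∷ f) =
    trans (+-cong (sym (-‿distribˡ-* a (h ν))) (pair-neg h f)) (⁻¹-∙-comm _ _)

  pair-scale : ∀ h a ν g → pair h (scale (a , ν) g) ≈ a * pair (λ μ → h (ν ∙ μ)) g
  pair-scale h a ν []            = sym (zeroʳ a)
  pair-scale h a ν ((b , μ) ∷ g) = begin
    a * b * h (ν ∙ μ) + pair h (scale (a , ν) g)           ≈⟨ +-congˡ (pair-scale h a ν g) ⟩
    a * b * h (ν ∙ μ) + a * pair (λ μ → h (ν ∙ μ)) g       ≈⟨ +-congʳ (*-assoc _ _ _) ⟩
    a * (b * h (ν ∙ μ)) + a * pair (λ μ → h (ν ∙ μ)) g     ≈⟨ distribˡ _ _ _ ⟨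
    a * (b * h (ν ∙ μ) + pair (λ μ → h (ν ∙ μ)) g)         ∎

  pair-⊛ : ∀ h f g → pair h (f ⊛ g) ≈ pair (λ ν → pair (λ μ → h (ν ∙ μ)) g) f
  pair-⊛ h []            g = refl
  pair-⊛ h ((a , ν) ∷ f) g = trans (pair-++ h (scale (a , ν) g) (f ⊛ g))
    (+-cong (pair-scale h a ν g) (pair-⊛ h f g))

  pair-0 : ∀ f → pair (λ _ → 0#) f ≈ 0#
  pair-0 []      = refl
  pair-0 (t ∷ f) = trans (+-cong (zeroʳ _) (pair-0 f)) (+-identityˡ _)

  pair-+* : ∀ h k b f → pair (λ ν → b * h ν + k ν) f ≈ b * pair h f + pair k f
  pair-+* h k b []            = sym (trans (+-congʳ (zeroʳ b)) (+-identityˡ _))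
  pair-+* h k b ((a , ν) ∷ f) = trans (+-congˡ (pair-+* h k b f))
    (solve 6 (λ a b x y p q → a :* (b :* x :+ y) :+ (b :* p :+ q)
                           := b :* (a :* x :+ p) :+ (a :* y :+ q))
      refl a b (h ν) (k ν) (pair h f) (pair k f))

  pair-swap : ∀ (h : Monomial → Monomial → Carrier) f g →
              pair (λ ν → pair (h ν) g) f ≈ pair (λ μ → pair (λ ν → h ν μ) f) g
  pair-swap h []            g = sym (pair-0 g)
  pair-swap h ((a , ν) ∷ f) g = trans (+-congˡ (pair-swap h f g))
    (sym (pair-+* (h ν) (λ μ → pair (λ ν → h ν μ) f) a g))

  remove : Monomial → Poly → Poly
  remove ν [] = []
  remove ν ((b , ρ) ∷ f) with ρ ≟ ν
  ... | yes _ = remove ν f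
  ... | no  _ = (b , ρ) ∷ remove ν f

  length-remove : ∀ ν f → length (remove ν f) ≤ length f
  length-remove ν [] = z≤n
  length-remove ν ((b , ρ) ∷ f) with ρ ≟ ν
  ... | yes _ = ℕ.m≤n⇒m≤1+n (length-remove ν f)
  ... | no  _ = s≤s (length-remove ν f)

  pair-remove : ∀ h ν f → pair h f ≈ coeff ν f * h ν + pair h (remove ν f)
  pair-remove h ν [] = sym (trans (+-identityʳ _) (zeroˡ _))
  pair-remove h ν ((b , ρ) ∷ f) with ρ ≟ ν
  ... | yes ≡.refl = trans (+-congˡ (pair-remove h ν f))
    (solve 4 (λ b x c p → b :* x :+ (c :* x :+ p) := (b :* con 1 :+ c) :* x :+ p)
      refl b (h ν) (coeff ν f) (pair h (remove ν f)))
  ... | no  _ = trans (+-congˡ (pair-remove h ν f))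
    (solve 5 (λ b x c y p → b :* x :+ (c :* y :+ p) := (b :* con 0 :+ c) :* y :+ (b :* x :+ p))
      refl b (h ρ) (coeff ν f) (h ν) (pair h (remove ν f)))

  remove-head : ∀ a ν f → remove ν ((a , ν) ∷ f) ≡ remove ν f
  remove-head a ν f with ν ≟ ν
  ... | yes _ = ≡.refl
  ... | no ¬p = ⊥-elim (¬p ≡.refl)

  pair-zero′ : ∀ n f → length f ≤ n → (∀ μ → coeff μ f ≈ 0#) → ∀ h → pair h f ≈ 0#
  pair-zero′ _       []            _       z h = refl
  pair-zero′ (suc n) F@((a , ν) ∷ f) (s≤s l) z h = begin
    pair h F                                      ≈⟨ pair-remove h ν F ⟩
    coeff ν F * h ν + pair h (remove ν F)         ≈⟨ +-congʳ (trans (*-congʳ (z ν)) (zeroˡ _)) ⟩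
    0# + pair h (remove ν F)                      ≈⟨ +-identityˡ _ ⟩
    pair h (remove ν F)                           ≡⟨ ≡.cong (pair h) (remove-head a ν f) ⟩
    pair h (remove ν f)                           ≈⟨ pair-zero′ n (remove ν f)
                                                       (ℕ.≤-trans (length-remove ν f) l) z′ h ⟩
    0#                                            ∎
    where
    z′ : ∀ μ → coeff μ (remove ν f) ≈ 0#
    z′ μ = begin
      coeff μ (remove ν f)                                       ≡⟨ ≡.cong (coeff μ) (remove-head a ν f) ⟨
      coeff μ (remove ν F)                                       ≈⟨ +-identityˡ _ ⟨
      0# + coeff μ (remove ν F)                                  ≈⟨ +-congʳ (trans (*-congʳ (z ν)) (zeroˡ _)) ⟨
      coeff ν F * indicator μ ν + coeff μ (remove ν F)           ≈⟨ pair-remove (indicator μ) ν F ⟨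
      coeff μ F                                                  ≈⟨ z μ ⟩
      0#                                                         ∎

  -- Every linear functional of the monomials is determined by the coefficients.
  pair-resp : ∀ {f g} → f ≋ g → ∀ h → pair h f ≈ pair h g
  pair-resp {f} {g} e h = x∙y⁻¹≈ε⇒x≈y _ _ (begin
    pair h f - pair h g       ≈⟨ +-congˡ (pair-neg h g) ⟨
    pair h f + pair h (neg g) ≈⟨ pair-++ h f (neg g) ⟨
    pair h (f ++ neg g)       ≈⟨ pair-zero′ _ (f ++ neg g) ℕ.≤-refl z h ⟩
    0#                        ∎)
    where
    z : ∀ μ → coeff μ (f ++ neg g) ≈ 0#
    z μ = trans (pair-++ _ f (neg g))
      (trans (+-congˡ (pair-neg _ g)) (x≈y⇒x∙y⁻¹≈ε (at e μ)))

  ⊛-cong : ∀ {f f′ g g′} → f ≋ f′ → g ≋ g′ → f ⊛ g ≋ f′ ⊛ g′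
  ⊛-cong {f} {f′} {g} {g′} e e′ = coeffwise λ μ → begin
    coeff μ (f ⊛ g)                                           ≈⟨ pair-⊛ _ f g ⟩
    pair (λ ν → pair (λ ρ → indicator μ (ν ∙ ρ)) g) f         ≈⟨ pair-resp e _ ⟩
    pair (λ ν → pair (λ ρ → indicator μ (ν ∙ ρ)) g) f′        ≈⟨ pair-cong (λ ν → pair-resp e′ _) f′ ⟩
    pair (λ ν → pair (λ ρ → indicator μ (ν ∙ ρ)) g′) f′       ≈⟨ pair-⊛ _ f′ g′ ⟨
    coeff μ (f′ ⊛ g′)                                         ∎

  ⊛-comm : ∀ f g → f ⊛ g ≋ g ⊛ f
  ⊛-comm f g = coeffwise λ μ → begin
    coeff μ (f ⊛ g)                                           ≈⟨ pair-⊛ _ f g ⟩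
    pair (λ ν → pair (λ ρ → indicator μ (ν ∙ ρ)) g) f         ≈⟨ pair-swap _ f g ⟩
    pair (λ ρ → pair (λ ν → indicator μ (ν ∙ ρ)) f) g         ≈⟨ pair-cong (λ ρ → pair-cong (λ ν →
                                                                   reflexive (≡.cong (indicator μ) (∙-comm ν ρ))) f) g ⟩
    pair (λ ρ → pair (λ ν → indicator μ (ρ ∙ ν)) f) g         ≈⟨ pair-⊛ _ g f ⟨
    coeff μ (g ⊛ f)                                           ∎

  ⊛-assoc : ∀ f g k → (f ⊛ g) ⊛ k ≋ f ⊛ (g ⊛ k)
  ⊛-assoc f g k = coeffwise λ μ → let h = indicator μ in begin
    pair h ((f ⊛ g) ⊛ k)                                                ≈⟨ pair-⊛ _ (f ⊛ g) k ⟩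
    pair (λ σ → pair (λ τ → h (σ ∙ τ)) k) (f ⊛ g)                       ≈⟨ pair-⊛ _ f g ⟩
    pair (λ ν → pair (λ ρ → pair (λ τ → h (ν ∙ ρ ∙ τ)) k) g) f          ≈⟨ pair-cong (λ ν → pair-cong (λ ρ → pair-cong (λ τ →
                                                                             reflexive (≡.cong h (∙-assoc ν ρ τ))) k) g) f ⟩
    pair (λ ν → pair (λ ρ → pair (λ τ → h (ν ∙ (ρ ∙ τ))) k) g) f        ≈⟨ pair-cong (λ ν → pair-⊛ _ g k) f ⟨
    pair (λ ν → pair (λ σ → h (ν ∙ σ)) (g ⊛ k)) f                       ≈⟨ pair-⊛ _ f (g ⊛ k) ⟨
    pair h (f ⊛ (g ⊛ k))                                                ∎

  ⊛-identityˡ : ∀ f → const 1# ⊛ f ≋ f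
  ⊛-identityˡ f = coeffwise λ μ → begin
    coeff μ (const 1# ⊛ f)                          ≈⟨ pair-⊛ _ (const 1#) f ⟩
    1# * pair (λ ρ → indicator μ (ε ∙ ρ)) f + 0#    ≈⟨ trans (+-identityʳ _) (*-identityˡ _) ⟩
    pair (λ ρ → indicator μ (ε ∙ ρ)) f              ≈⟨ pair-cong (λ ρ → reflexive (≡.cong (indicator μ) (∙-identityˡ ρ))) f ⟩
    coeff μ f                                       ∎

  ⊛-distribʳ : ∀ f g k → (g ++ k) ⊛ f ≋ (g ⊛ f) ++ (k ⊛ f)
  ⊛-distribʳ f g k = coeffwise λ μ → begin
    coeff μ ((g ++ k) ⊛ f)                 ≈⟨ pair-⊛ _ (g ++ k) f ⟩
    pair _ (g ++ k)                        ≈⟨ pair-++ _ g k ⟩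
    pair _ g + pair _ k                    ≈⟨ +-cong (pair-⊛ _ g f) (pair-⊛ _ k f) ⟨
    coeff μ (g ⊛ f) + coeff μ (k ⊛ f)      ≈⟨ pair-++ _ (g ⊛ f) (k ⊛ f) ⟨
    coeff μ ((g ⊛ f) ++ (k ⊛ f))           ∎

  ++-comm : ∀ f g → f ++ g ≋ g ++ f
  ++-comm f g = coeffwise λ μ → trans (pair-++ _ f g) (trans (+-comm _ _) (sym (pair-++ _ g f)))

  ++-cong : ∀ {f f′ g g′} → f ≋ f′ → g ≋ g′ → f ++ g ≋ f′ ++ g′
  ++-cong {f} {f′} {g} {g′} e e′ = coeffwise λ μ →
    trans (pair-++ _ f g) (trans (+-cong (at e μ) (at e′ μ)) (sym (pair-++ _ f′ g′)))

  neg-inverseˡ : ∀ f → neg f ++ f ≋ []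
  neg-inverseˡ f = coeffwise λ μ → trans (pair-++ _ (neg f) f) (trans (+-congʳ (pair-neg _ f)) (-‿inverseˡ _))

  ≋-trans : ∀ {f g k} → f ≋ g → g ≋ k → f ≋ k
  ≋-trans e e′ = coeffwise λ μ → trans (at e μ) (at e′ μ)

  ring[] : CommutativeRing c ℓ
  CommutativeRing.Carrier ring[] = Poly
  CommutativeRing._≈_ ring[] = _≋_
  CommutativeRing._+_ ring[] = _++_
  CommutativeRing._*_ ring[] = _⊛_
  CommutativeRing.-_ ring[] = neg
  CommutativeRing.0# ring[] = []
  CommutativeRing.1# ring[] = const 1#
  CommutativeRing.isCommutativeRing ring[] = record
      { isRing = record
        { +-isAbelianGroup = record
          { isGroup = record
            { isMonoid = record
              { isSemigroup = record
                { isMagma = record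
                  { isEquivalence = record
                    { refl = coeffwise λ _ → refl
                    ; sym = λ e → coeffwise λ μ → sym (at e μ)
                    ; trans = ≋-trans
                    }
                  ; ∙-cong = ++-cong
                  }
                ; assoc = λ f g k → coeffwise λ μ → begin
                    coeff μ ((f ++ g) ++ k)                 ≈⟨ pair-++ _ (f ++ g) k ⟩
                    coeff μ (f ++ g) + coeff μ k            ≈⟨ +-congʳ (pair-++ _ f g) ⟩
                    coeff μ f + coeff μ g + coeff μ k       ≈⟨ +-assoc _ _ _ ⟩
                    coeff μ f + (coeff μ g + coeff μ k)     ≈⟨ +-congˡ (pair-++ _ g k) ⟨
                    coeff μ f + coeff μ (g ++ k)            ≈⟨ pair-++ _ f (g ++ k) ⟨
                    coeff μ (f ++ (g ++ k))                 ∎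
                }
              ; identity = (λ f → coeffwise λ μ → refl) , (λ f → ++-comm f [])
              }
            ; inverse = neg-inverseˡ
                      , (λ f → ≋-trans (++-comm f (neg f)) (neg-inverseˡ f))
            ; ⁻¹-cong = λ {f} {g} e → coeffwise λ μ → trans (pair-neg _ f) (trans (-‿cong (at e μ)) (sym (pair-neg _ g)))
            }
          ; comm = ++-comm
          }
        ; *-cong = ⊛-cong
        ; *-assoc = ⊛-assoc
        ; *-identity = ⊛-identityˡ
                     , (λ f → ≋-trans (⊛-comm f (const 1#)) (⊛-identityˡ f))
        ; distrib = (λ f g k → ≋-trans
                      (⊛-comm f (g ++ k))
                      (≋-trans (⊛-distribʳ f g k)
                        (++-cong (⊛-comm g f) (⊛-comm k f))))
                  , ⊛-distribʳ
        }
      ; *-comm = ⊛-comm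
      }

module Localization (R : CommutativeRing c ℓ) (d : CommutativeRing.Carrier R) where
  open CommutativeRing R hiding (zero)
  open Arith R
  open ArithProperties R
  open import Relation.Binary.Reasoning.Setoid setoid
  open import Algebra.Solver.Ring.NaturalCoefficients.Default commutativeSemiring
    using (solve; _:=_; _:+_; _:*_; con)

  record Fraction : Set (c ⊔ ℓ) where
    no-eta-equality
    field
      numer denom : Carrier
      isPower     : ∃ λ k → denom ≈ d ^ k
  open Fraction public

  infix 3 _witnesses_
  infix 4 _≃_
  record _≃_ (f g : Fraction) : Set ℓ where
    constructor _witnesses_
    field
      exponent : ℕ
      equality : d ^ exponent * (numer f * denom g) ≈ d ^ exponent * (numer g * denom f)

  fromRing : Carrier → Fraction
  fromRing a .numer   = a
  fromRing a .denom   = 1#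
  fromRing a .isPower = 0 , refl

  power-* : ∀ {s t} → (∃ λ k → s ≈ d ^ k) → (∃ λ k → t ≈ d ^ k) → ∃ λ k → s * t ≈ d ^ k
  power-* (k , e) (l , f) = k ℕ.+ l , trans (*-cong e f) (sym (^-homo-* d k l))

  exact : ∀ {f g} → numer f * denom g ≈ numer g * denom f → f ≃ g
  exact e = 0 witnesses *-congˡ e

  add mul : Fraction → Fraction → Fraction
  add F G .numer   = numer F * denom G + numer G * denom F
  add F G .denom   = denom F * denom G
  add F G .isPower = power-* (isPower F) (isPower G)
  mul F G .numer   = numer F * numer G
  mul F G .denom   = denom F * denom G
  mul F G .isPower = power-* (isPower F) (isPower G)

  opp : Fraction → Fraction
  opp F .numer   = - numer F
  opp F .denom   = denom F
  opp F .isPower = isPower F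

  ≃-trans : ∀ {f g h} → f ≃ g → g ≃ h → f ≃ h
  ≃-trans {F} {G} {H} (k witnesses e) (l witnesses e′) = k ℕ.+ l ℕ.+ j witnesses (begin
    d ^ (k ℕ.+ l ℕ.+ j) * (f * r)             ≈⟨ *-congʳ split ⟩
    d ^ k * d ^ l * t * (f * r)               ≈⟨ solve 5 (λ u v t f r → u :* v :* t :* (f :* r)
                                                   := (v :* r) :* (u :* (f :* t))) refl (d ^ k) (d ^ l) t f r ⟩
    (d ^ l * r) * (d ^ k * (f * t))           ≈⟨ *-congˡ e ⟩
    (d ^ l * r) * (d ^ k * (g * s))           ≈⟨ solve 5 (λ u v s g r → (v :* r) :* (u :* (g :* s))
                                                   := (u :* s) :* (v :* (g :* r))) refl (d ^ k) (d ^ l) s g r ⟩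
    (d ^ k * s) * (d ^ l * (g * r))           ≈⟨ *-congˡ e′ ⟩
    (d ^ k * s) * (d ^ l * (h * t))           ≈⟨ solve 5 (λ u v t h s → (u :* s) :* (v :* (h :* t))
                                                   := u :* v :* t :* (h :* s)) refl (d ^ k) (d ^ l) t h s ⟩
    d ^ k * d ^ l * t * (h * s)               ≈⟨ *-congʳ split ⟨
    d ^ (k ℕ.+ l ℕ.+ j) * (h * s)             ∎)
    where
    open Fraction F using () renaming (numer to f; denom to s)
    open Fraction G using () renaming (numer to g; denom to t)
    open Fraction H using () renaming (numer to h; denom to r)
    j  = proj₁ (isPower G)
    t≈ = proj₂ (isPower G)
    split : d ^ (k ℕ.+ l ℕ.+ j) ≈ d ^ k * d ^ l * t
    split = trans (^-homo-* d (k ℕ.+ l) j) (*-cong (^-homo-* d k l) (sym t≈))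

  add-cong : ∀ {f f′ g g′} → f ≃ f′ → g ≃ g′ → add f g ≃ add f′ g′
  add-cong {F} {F′} {G} {G′} (k witnesses e) (l witnesses e′) = k ℕ.+ l witnesses (begin
    d ^ (k ℕ.+ l) * ((f * t + g * s) * (s′ * t′))         ≈⟨ *-congʳ (^-homo-* d k l) ⟩
    u * v * ((f * t + g * s) * (s′ * t′))
      ≈⟨ solve 8 (λ u v f g s t s′ t′ → u :* v :* ((f :* t :+ g :* s) :* (s′ :* t′))
                 := v :* t :* t′ :* (u :* (f :* s′)) :+ u :* s :* s′ :* (v :* (g :* t′)))
           refl u v f g s t s′ t′ ⟩
    v * t * t′ * (u * (f * s′)) + u * s * s′ * (v * (g * t′))
      ≈⟨ +-cong (*-congˡ e) (*-congˡ e′) ⟩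
    v * t * t′ * (u * (f′ * s)) + u * s * s′ * (v * (g′ * t))
      ≈⟨ solve 8 (λ u v f g s t s′ t′ → v :* t :* t′ :* (u :* (f :* s)) :+ u :* s :* s′ :* (v :* (g :* t))
                 := u :* v :* ((f :* t′ :+ g :* s′) :* (s :* t)))
           refl u v f′ g′ s t s′ t′ ⟩
    u * v * ((f′ * t′ + g′ * s′) * (s * t))               ≈⟨ *-congʳ (^-homo-* d k l) ⟨
    d ^ (k ℕ.+ l) * ((f′ * t′ + g′ * s′) * (s * t))       ∎)
    where
    open Fraction F using () renaming (numer to f; denom to s)
    open Fraction F′ using () renaming (numer to f′; denom to s′)
    open Fraction G using () renaming (numer to g; denom to t)
    open Fraction G′ using () renaming (numer to g′; denom to t′)
    u = d ^ k
    v = d ^ l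

  mul-cong : ∀ {f f′ g g′} → f ≃ f′ → g ≃ g′ → mul f g ≃ mul f′ g′
  mul-cong {F} {F′} {G} {G′} (k witnesses e) (l witnesses e′) = k ℕ.+ l witnesses (begin
    d ^ (k ℕ.+ l) * ((f * g) * (s′ * t′))    ≈⟨ *-congʳ (^-homo-* d k l) ⟩
    u * v * ((f * g) * (s′ * t′))            ≈⟨ shuffle u v f g s′ t′ ⟩
    (u * (f * s′)) * (v * (g * t′))          ≈⟨ *-cong e e′ ⟩
    (u * (f′ * s)) * (v * (g′ * t))          ≈⟨ shuffle u v f′ g′ s t ⟨
    u * v * ((f′ * g′) * (s * t))            ≈⟨ *-congʳ (^-homo-* d k l) ⟨
    d ^ (k ℕ.+ l) * ((f′ * g′) * (s * t))    ∎)
    where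
    open Fraction F using () renaming (numer to f; denom to s)
    open Fraction F′ using () renaming (numer to f′; denom to s′)
    open Fraction G using () renaming (numer to g; denom to t)
    open Fraction G′ using () renaming (numer to g′; denom to t′)
    u = d ^ k
    v = d ^ l
    shuffle : ∀ u v f g s t → u * v * ((f * g) * (s * t)) ≈ (u * (f * s)) * (v * (g * t))
    shuffle = solve 6 (λ u v f g s t → u :* v :* ((f :* g) :* (s :* t))
                                    := (u :* (f :* s)) :* (v :* (g :* t))) refl

  opp-cong : ∀ {f f′} → f ≃ f′ → opp f ≃ opp f′
  opp-cong {F} {F′} (k witnesses e) = k witnesses (begin
    d ^ k * (- f * s′)      ≈⟨ pull f s′ ⟩
    - (d ^ k * (f * s′))    ≈⟨ -‿cong e ⟩
    - (d ^ k * (f′ * s))    ≈⟨ pull f′ s ⟨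
    d ^ k * (- f′ * s)      ∎)
    where
    open Fraction F using () renaming (numer to f; denom to s)
    open Fraction F′ using () renaming (numer to f′; denom to s′)
    pull : ∀ f s → d ^ k * (- f * s) ≈ - (d ^ k * (f * s))
    pull f s = trans (*-congˡ (sym (-‿distribˡ-* f s))) (sym (-‿distribʳ-* _ _))

  add-comm : ∀ f g → add f g ≃ add g f
  add-comm F G = exact
    (solve 4 (λ f g s t → (f :* t :+ g :* s) :* (t :* s) := (g :* s :+ f :* t) :* (s :* t)) refl f g s t)
    where
    open Fraction F using () renaming (numer to f; denom to s)
    open Fraction G using () renaming (numer to g; denom to t)

  mul-comm : ∀ f g → mul f g ≃ mul g f
  mul-comm F G = exact
    (solve 4 (λ f g s t → (f :* g) :* (t :* s) := (g :* f) :* (s :* t)) refl f g s t)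
    where
    open Fraction F using () renaming (numer to f; denom to s)
    open Fraction G using () renaming (numer to g; denom to t)

  add-identityˡ : ∀ f → add (fromRing 0#) f ≃ f
  add-identityˡ F = exact
    (solve 2 (λ f s → (con 0 :* s :+ f :* con 1) :* s := f :* (con 1 :* s)) refl f s)
    where
    open Fraction F using () renaming (numer to f; denom to s)

  mul-identityˡ : ∀ f → mul (fromRing 1#) f ≃ f
  mul-identityˡ F = exact
    (solve 2 (λ f s → (con 1 :* f) :* s := f :* (con 1 :* s)) refl f s)
    where
    open Fraction F using () renaming (numer to f; denom to s)

  opp-inverseˡ : ∀ f → add (opp f) f ≃ fromRing 0#
  opp-inverseˡ F = exact (begin
    (- f * s + f * s) * 1#    ≈⟨ *-congʳ (sym (distribʳ s (- f) f)) ⟩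
    ((- f + f) * s) * 1#      ≈⟨ *-congʳ (*-congʳ (-‿inverseˡ f)) ⟩
    (0# * s) * 1#             ≈⟨ *-congʳ (zeroˡ s) ⟩
    0# * 1#                   ≈⟨ zeroˡ _ ⟩
    0#                        ≈⟨ zeroˡ _ ⟨
    0# * (s * s)              ∎)
    where
    open Fraction F using () renaming (numer to f; denom to s)

  mul-distribʳ : ∀ f g h → mul (add g h) f ≃ add (mul g f) (mul h f)
  mul-distribʳ F G H = exact
    (solve 6 (λ f g h s t r → ((g :* r :+ h :* t) :* f) :* ((t :* s) :* (r :* s))
                           := ((g :* f) :* (r :* s) :+ (h :* f) :* (t :* s)) :* ((t :* r) :* s))
      refl f g h s t r)
    where
    open Fraction F using () renaming (numer to f; denom to s)
    open Fraction G using () renaming (numer to g; denom to t)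
    open Fraction H using () renaming (numer to h; denom to r)

  add-assoc : ∀ f g h → add (add f g) h ≃ add f (add g h)
  add-assoc F G H = exact
    (solve 6 (λ f g h s t r →
        ((f :* t :+ g :* s) :* r :+ h :* (s :* t)) :* (s :* (t :* r))
     := (f :* (t :* r) :+ (g :* r :+ h :* t) :* s) :* ((s :* t) :* r))
      refl f g h s t r)
    where
    open Fraction F using () renaming (numer to f; denom to s)
    open Fraction G using () renaming (numer to g; denom to t)
    open Fraction H using () renaming (numer to h; denom to r)

  mul-assoc : ∀ f g h → mul (mul f g) h ≃ mul f (mul g h)
  mul-assoc F G H = exact
    (solve 6 (λ f g h s t r → ((f :* g) :* h) :* (s :* (t :* r))
                           := (f :* (g :* h)) :* ((s :* t) :* r)) refl f g h s t r)
    where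
    open Fraction F using () renaming (numer to f; denom to s)
    open Fraction G using () renaming (numer to g; denom to t)
    open Fraction H using () renaming (numer to h; denom to r)

  mul-distribˡ : ∀ f g h → mul f (add g h) ≃ add (mul f g) (mul f h)
  mul-distribˡ F G H = exact
    (solve 6 (λ f g h s t r → (f :* (g :* r :+ h :* t)) :* ((s :* t) :* (s :* r))
                           := ((f :* g) :* (s :* r) :+ (f :* h) :* (s :* t)) :* (s :* (t :* r)))
      refl f g h s t r)
    where
    open Fraction F using () renaming (numer to f; denom to s)
    open Fraction G using () renaming (numer to g; denom to t)
    open Fraction H using () renaming (numer to h; denom to r)

  localization : CommutativeRing (c ⊔ ℓ) ℓ
  CommutativeRing.Carrier localization = Fraction
  CommutativeRing._≈_ localization = _≃_
  CommutativeRing._+_ localization = add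
  CommutativeRing._*_ localization = mul
  CommutativeRing.-_ localization = opp
  CommutativeRing.0# localization = fromRing 0#
  CommutativeRing.1# localization = fromRing 1#
  CommutativeRing.isCommutativeRing localization = record
      { isRing = record
        { +-isAbelianGroup = record
          { isGroup = record
            { isMonoid = record
              { isSemigroup = record
                { isMagma = record
                  { isEquivalence = record
                    { refl = exact refl
                    ; sym = λ (k witnesses e) → k witnesses sym e
                    ; trans = ≃-trans
                    }
                  ; ∙-cong = add-cong
                  }
                ; assoc = add-assoc
                }
              ; identity = add-identityˡ
                         , (λ f → ≃-trans (add-comm f (fromRing 0#)) (add-identityˡ f))
              }
            ; inverse = opp-inverseˡ
                      , (λ f → ≃-trans (add-comm f (opp f)) (opp-inverseˡ f))
            ; ⁻¹-cong = opp-cong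
            }
          ; comm = add-comm
          }
        ; *-cong = mul-cong
        ; *-assoc = mul-assoc
        ; *-identity = mul-identityˡ
                     , (λ f → ≃-trans (mul-comm f (fromRing 1#)) (mul-identityˡ f))
        ; distrib = mul-distribˡ
                  , mul-distribʳ
        }
      ; *-comm = mul-comm
      }

-- lim R/dⁿ, an element being given by representatives of its images in R/dⁿ.
-- The copattern definitions (here and for fractions) keep the ring operations
-- from unfolding during conversion checking.
module Completion (R : CommutativeRing c ℓ) (d : CommutativeRing.Carrier R) where
  open CommutativeRing R hiding (zero)
  open Arith R
  open ArithProperties R

  record Coherent : Set (c ⊔ ℓ) where
    no-eta-equality
    field
      seq  : ℕ → Carrier
      step : ∀ n → seq (suc n) ≡ seq n [mod d ^ n ]
  open Coherent public

  infix 4 _≅_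
  record _≅_ (u v : Coherent) : Set (c ⊔ ℓ) where
    constructor termwise
    field at : ∀ n → seq u n ≡ seq v n [mod d ^ n ]
  open _≅_ public

  fromRing : Carrier → Coherent
  fromRing a .seq  n = a
  fromRing a .step n = mod-reflexive refl

  add mul : Coherent → Coherent → Coherent
  add u v .seq  n = seq u n + seq v n
  add u v .step n = mod-+ (step u n) (step v n)
  mul u v .seq  n = seq u n * seq v n
  mul u v .step n = mod-* (step u n) (step v n)

  opp : Coherent → Coherent
  opp u .seq  n = - seq u n
  opp u .step n = mod-neg (step u n)

  pointwise : ∀ {u v} → (∀ n → seq u n ≈ seq v n) → u ≅ v
  pointwise e = termwise λ n → mod-reflexive (e n)

  completion : CommutativeRing (c ⊔ ℓ) (c ⊔ ℓ)
  CommutativeRing.Carrier completion = Coherent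
  CommutativeRing._≈_ completion = _≅_
  CommutativeRing._+_ completion = add
  CommutativeRing._*_ completion = mul
  CommutativeRing.-_ completion = opp
  CommutativeRing.0# completion = fromRing 0#
  CommutativeRing.1# completion = fromRing 1#
  CommutativeRing.isCommutativeRing completion = record
      { isRing = record
        { +-isAbelianGroup = record
          { isGroup = record
            { isMonoid = record
              { isSemigroup = record
                { isMagma = record
                  { isEquivalence = record
                    { refl = termwise λ n → mod-reflexive refl
                    ; sym = λ e → termwise λ n → mod-sym (at e n)
                    ; trans = λ e e′ → termwise λ n → mod-trans (at e n) (at e′ n)
                    }
                  ; ∙-cong = λ e e′ → termwise λ n → mod-+ (at e n) (at e′ n)
                  }
                ; assoc = λ u v w → pointwise (λ n → +-assoc _ _ _)
                }
              ; identity = (λ u → pointwise (λ n → +-identityˡ _)) , (λ u → pointwise (λ n → +-identityʳ _))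
              }
            ; inverse = (λ u → pointwise (λ n → -‿inverseˡ _)) , (λ u → pointwise (λ n → -‿inverseʳ _))
            ; ⁻¹-cong = λ e → termwise λ n → mod-neg (at e n)
            }
          ; comm = λ u v → pointwise (λ n → +-comm _ _)
          }
        ; *-cong = λ e e′ → termwise λ n → mod-* (at e n) (at e′ n)
        ; *-assoc = λ u v w → pointwise (λ n → *-assoc _ _ _)
        ; *-identity = (λ u → pointwise (λ n → *-identityˡ _)) , (λ u → pointwise (λ n → *-identityʳ _))
        ; distrib = (λ u v w → pointwise (λ n → distribˡ _ _ _)) , (λ u v w → pointwise (λ n → distribʳ _ _ _))
        }
      ; *-comm = λ u v → pointwise (λ n → *-comm _ _)
      }

∤! : ∀ {p} → Prime p → ∀ k → k < p → ¬ (p ℕ.∣ k !)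
∤! pr zero    k<p p∣1 = ℕ.<⇒≱ (ℕ.nonTrivial⇒n>1 _ {{prime⇒nonTrivial pr}}) (ℕ.∣⇒≤ p∣1)
∤! pr (suc k) k<p p∣k! with euclidsLemma (suc k) (k !) pr p∣k!
... | inj₁ p∣1+k = ℕ.<⇒≱ k<p (ℕ.∣⇒≤ p∣1+k)
... | inj₂ p∣k!′ = ∤! pr k (ℕ.<-trans (ℕ.n<1+n k) k<p) p∣k!′

∣C : ∀ {p} → Prime p → ∀ k → 0 < k → k < p → p ℕ.∣ (p C k)
∣C {p} pr k 0<k k<p with euclidsLemma (p C k) (k ! ℕ.* (p ∸ k) !) pr p∣C*d
  where
  instance
    d≢0 = k ℕ.!* (p ∸ k) !≢0
    p≢0 = prime⇒nonZero pr
  C*d : (p C k) ℕ.* (k ! ℕ.* (p ∸ k) !) ≡ p !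
  C*d = ≡.trans (≡.cong (ℕ._* (k ! ℕ.* (p ∸ k) !)) (nCk≡n!/k![n-k]! (ℕ.<⇒≤ k<p)))
                (ℕ.m/n*n≡m (k![n∸k]!∣n! (ℕ.<⇒≤ k<p)))
  p∣p! : ∀ p .{{_ : ℕ.NonZero p}} → p ℕ.∣ p !
  p∣p! (suc p) = ℕ.m∣m*n (p !)
  p∣C*d : p ℕ.∣ (p C k) ℕ.* (k ! ℕ.* (p ∸ k) !)
  p∣C*d = ≡.subst (p ℕ.∣_) (≡.sym C*d) (p∣p! p)
... | inj₁ p∣C = p∣C
... | inj₂ p∣d with euclidsLemma (k !) ((p ∸ k) !) pr p∣d
...   | inj₁ p∣k! = ⊥-elim (∤! pr k k<p p∣k!)
...   | inj₂ p∣e  = ⊥-elim (∤! pr (p ∸ k) (ℕ.∸-monoʳ-< 0<k (ℕ.<⇒≤ k<p)) p∣e)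

module PthPower (R : CommutativeRing c ℓ) {p : ℕ} (pr : Prime p) where
  open CommutativeRing R hiding (zero)
  open Arith R
  open ArithProperties R
  open import Algebra.Properties.CommutativeSemiring.Binomial commutativeSemiring
    using (binomialTerm; theorem)
  open import Algebra.Properties.CommutativeSemiring.Exp commutativeSemiring
    using (^-distrib-*)
  open import Relation.Binary.Reasoning.Setoid setoid

  ∣-• : ∀ {n} y → p ℕ.∣ n → num p ∣ (n • y)
  ∣-• {n} y (ℕ.divides q ≡.refl) = q • y , (begin
    (q • y) * (p • 1#)    ≈⟨ *-comm _ _ ⟩
    (p • 1#) * (q • y)    ≈⟨ ×-assoc-* p 1# (q • y) ⟩
    p • (1# * (q • y))    ≈⟨ ×-congʳ p (*-identityˡ _) ⟩
    p • (q • y)           ≈⟨ ×-assocˡ y p q ⟩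
    (p ℕ.* q) • y         ≡⟨ ≡.cong (_• y) (ℕ.*-comm p q) ⟩
    (q ℕ.* p) • y         ∎)

  ∣-sum : ∀ {n} {f : Fin n → Carrier} → (∀ i → num p ∣ f i) → num p ∣ sum f
  ∣-sum {zero}  h = ∣-0
  ∣-sum {suc n} h = ∣-+ (h zero) (∣-sum (h ∘ suc))

  ^-+ : ∀ x y → (x + y) ^ p ≡ x ^ p + y ^ p [mod num p ]
  ^-+ x y = go p ≡.refl
    where
    go : ∀ n → n ≡ p → (x + y) ^ p ≡ x ^ p + y ^ p [mod num p ]
    go zero    ≡.refl = ⊥-elim (ℕ.≢-nonZero⁻¹ 0 {{prime⇒nonZero pr}} ≡.refl)
    go (suc n) ≡.refl = ∣-resp eq (∣-sum mid∣)
      where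
      T   = binomialTerm x y (suc n)
      mid : Fin n → Carrier
      mid i = T (suc (Fin.inject₁ i))
      mid∣ : ∀ i → num p ∣ mid i
      mid∣ i = ∣-• _ (∣C pr _ (s≤s z≤n)
        (s≤s (≡.subst (_< n) (≡.sym (Fin.toℕ-inject₁ i)) (Fin.toℕ<n i))))
      first : T zero ≈ y ^ p
      first = trans (+-identityʳ _) (*-identityˡ _)
      final : T (suc (Fin.fromℕ n)) ≈ x ^ p
      final = begin
        (suc n C suc m) • (x ^ suc m * y ^ (n ∸ m))
          ≡⟨ ≡.cong (λ m → (suc n C suc m) • (x ^ suc m * y ^ (n ∸ m))) (Fin.toℕ-fromℕ n) ⟩
        (suc n C suc n) • (x ^ suc n * y ^ (n ∸ n))
          ≡⟨ ≡.cong₂ (λ a b → a • (x ^ suc n * y ^ b)) (nCn≡1 (suc n)) (ℕ.n∸n≡0 n) ⟩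
        1 • (x ^ suc n * 1#)
          ≈⟨ trans (+-identityʳ _) (*-identityʳ _) ⟩
        x ^ p ∎
        where m = toℕ (Fin.fromℕ n)
      eq : sum mid ≈ (x + y) ^ p - (x ^ p + y ^ p)
      eq = sym (begin
        (x + y) ^ p - (x ^ p + y ^ p)                   ≈⟨ +-congʳ (theorem p x y) ⟩
        (T zero + sum (T ∘ suc)) - (x ^ p + y ^ p)      ≈⟨ +-congʳ (+-cong first (sum-init-last (T ∘ suc))) ⟩
        (y ^ p + (sum mid + T (suc (Fin.fromℕ n)))) - (x ^ p + y ^ p)
                                                        ≈⟨ +-congʳ (+-congˡ (+-congˡ final)) ⟩
        (y ^ p + (sum mid + x ^ p)) - (x ^ p + y ^ p)   ≈⟨ +-congʳ (trans (+-comm _ _) (+-assoc _ _ _)) ⟩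
        (sum mid + (x ^ p + y ^ p)) - (x ^ p + y ^ p)   ≈⟨ +-assoc _ _ _ ⟩
        sum mid + ((x ^ p + y ^ p) - (x ^ p + y ^ p))   ≈⟨ +-congˡ (-‿inverseʳ _) ⟩
        sum mid + 0#                                    ≈⟨ +-identityʳ _ ⟩
        sum mid                                         ∎)

  ^-sum : ∀ {n} (f : Fin n → Carrier) → sum f ^ p ≡ sum (λ i → f i ^ p) [mod num p ]
  ^-sum {zero}  f = mod-reflexive (0^ p)
    where
    0^ : ∀ q .{{_ : ℕ.NonZero q}} → 0# ^ q ≈ 0#
    0^ (suc q) = zeroˡ _
    instance _ = prime⇒nonZero pr
  ^-sum {suc n} f = mod-trans (^-+ (f zero) (sum (f ∘ suc)))
    (mod-+ (mod-reflexive refl) (^-sum (f ∘ suc)))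

  ⁽⁾-· : ∀ {n} (A B : Matrix n) j k →
         ((A · B) ⁽ p ⁾) j k ≡ (A ⁽ p ⁾ · B ⁽ p ⁾) j k [mod num p ]
  ⁽⁾-· A B j k = mod-trans (^-sum (λ s → A j s * B s k))
    (mod-sum (λ s → mod-reflexive (^-distrib-* (A j s) (B s k) p)))

  ⁽⁾-·· : ∀ {n} (A B D : Matrix n) j k →
          ((A · B · D) ⁽ p ⁾) j k ≡ (A ⁽ p ⁾ · B ⁽ p ⁾ · D ⁽ p ⁾) j k [mod num p ]
  ⁽⁾-·· A B D j k = mod-trans (⁽⁾-· (A · B) D j k)
    (mod-sum (λ s → mod-* (⁽⁾-· A B j s) (mod-reflexive refl)))

record IsFrobeniusLift (R : CommutativeRing c ℓ) (p : ℕ)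
    (φ : CommutativeRing.Carrier R → CommutativeRing.Carrier R) : Set (c ⊔ ℓ) where
  open CommutativeRing R
  open Arith R
  field
    isRingHom : IsRingHom R R φ
    frobenius : ∀ a → φ a ≡ a ^ p [mod num p ]

-- Only used on p-torsion free rings, where a p-derivation δ amounts to the
-- requirement that φ a = aᵖ + p δ a be a (necessarily Frobenius lifting)
-- ring endomorphism.
record PDerivation (R : CommutativeRing c ℓ) (p : ℕ) : Set (c ⊔ ℓ) where
  open CommutativeRing R
  open Arith R
  field
    δ : Carrier → Carrier

  φ : Carrier → Carrier
  φ a = a ^ p + num p * δ a

  field
    δ-cong    : ∀ {a b} → a ≈ b → δ a ≈ δ b
    isRingHom : IsRingHom R R φ

module _ (R : CommutativeRing c ℓ) where
  open CommutativeRing R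
  open Arith R

  -- A domain, not a field, every nonzero element of which is a unit times a
  -- power of π; the nonunits are then exactly the multiples of π, so π
  -- generates the maximal ideal.
  record IsDVRWithUniformizer (π : Carrier) : Set (c ⊔ ℓ) where
    field
      1≉0            : 1# ≉ 0#
      noZeroDivisors : ∀ {x y} → x * y ≈ 0# → x ≈ 0# ⊎ y ≈ 0#
      π≉0            : π ≉ 0#
      π-nonunit      : ¬ (π ∣ 1#)
      factor         : ∀ {x} → x ≉ 0# → ∃₂ λ u k → u ∣ 1# × x ≈ u * π ^ k

  IsAdicallyComplete : Carrier → Set (c ⊔ ℓ)
  IsAdicallyComplete π =
    Bijective _≈_ (CommutativeRing._≈_ completion) fromRing
    where open Completion R π

  -- Perfectness of R/p: its Frobenius endomorphism is bijective.
  HasPerfectResidueRing : ℕ → Set (c ⊔ ℓ)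
  HasPerfectResidueRing p = Bijective _∼_ _∼_ (_^ p)
    where
    _∼_ : Carrier → Carrier → Set (c ⊔ ℓ)
    x ∼ y = x ≡ y [mod num p ]

  record IsCompleteDVRPerfectResidue (p : ℕ) : Set (c ⊔ ℓ) where
    field
      isDVR      : IsDVRWithUniformizer (num p)
      isComplete : IsAdicallyComplete (num p)
      isPerfect  : HasPerfectResidueRing p

module _ (R : CommutativeRing c ℓ) {p : ℕ} (odd : ¬ (2 ℕ.∣ p))
    (dvr : IsDVRWithUniformizer R (Arith.num R p)) where
  open CommutativeRing R
  open Arith R
  open ArithProperties R
  open IsDVRWithUniformizer dvr
  open import Relation.Binary.Reasoning.Setoid setoid

  half : ∃ λ h → h * num 2 ≈ 1#
  half = from-∣ 2∣1
    where
    r = p ℕ./ 2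
    p≡ : p ≡ 1 ℕ.+ r ℕ.* 2
    p≡ = odd-split (p ℕ.% 2) (ℕ.m%n<n p 2) (ℕ.m≡m%n+[m/n]*n p 2)
      where
      odd-split : ∀ e → e < 2 → p ≡ e ℕ.+ r ℕ.* 2 → p ≡ 1 ℕ.+ r ℕ.* 2
      odd-split 0 _ eq = ⊥-elim (odd (ℕ.divides r eq))
      odd-split 1 _ eq = eq
      odd-split (suc (suc e)) (s≤s (s≤s ())) eq
    num-p : num p ≈ 1# + num r * num 2
    num-p = trans (reflexive (≡.cong num p≡)) (+-congˡ (×1-homo-* r 2))
    ¬p∣2 : ¬ (num p ∣ num 2)
    ¬p∣2 p∣2 = π-nonunit (∣-resp (begin
      num p - num r * num 2                  ≈⟨ +-congʳ (trans num-p (+-comm _ _)) ⟩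
      (num r * num 2 + 1#) - num r * num 2   ≈⟨ xyx⁻¹≈y _ _ ⟩
      1#                                     ∎)
      (∣-+ (1# , *-identityˡ _) (∣-neg (∣-* (num r) p∣2))))
    2∣1 : num 2 ∣ 1#
    2∣1 with factor (λ 2≈0 → ¬p∣2 (∣-resp (sym 2≈0) ∣-0))
    ... | u , zero  , (v , vu≈1) , 2≈u   = v , trans (*-congˡ (trans 2≈u (*-identityʳ u))) vu≈1
    ... | u , suc k , _          , 2≈uπᵏ = ⊥-elim (¬p∣2 (∣-resp (sym 2≈uπᵏ)
            (∣-* u (∣-resp (*-comm _ _) (∣-* (num p ^ k) (1# , *-identityˡ _))))))
    from-∣ : num 2 ∣ 1# → ∃ λ h → h * num 2 ≈ 1#
    from-∣ (h , e) = h , e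

  ½ : Carrier
  ½ = proj₁ half

-- Stated for any A, ι : 𝒪 → A and matrix x over A; the intended instance is
-- A = 𝒪(Ĝ) with its matrix of coordinates x.
module Connections (𝒪 : CommutativeRing c ℓ) (A : CommutativeRing c′ ℓ′)
    (ι : CommutativeRing.Carrier 𝒪 → CommutativeRing.Carrier A)
    (p : ℕ) {n : ℕ} (x : Arith.Matrix A n) where
  private module O = Arith 𝒪
  open CommutativeRing A
  open Arith A

  ιM : O.Matrix n → Matrix n
  ιM q j k = ι (q j k)

  -- The conditions determine ℋ on 𝒪(Ĝ): every ring endomorphism preserves
  -- the ideals (pᵏ), so is continuous.
  record Isℋ (q : O.Matrix n) (ℋ : Carrier → Carrier) : Set (c ⊔ c′ ⊔ ℓ′) where
    field
      isRingHom : IsRingHom A A ℋ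
      on-𝒪      : ∀ a → ℋ (ι a) ≈ ι a
      on-x      : ∀ j k → ℋ (x j k) ≈ (x ᵗ · ιM q · x) j k

  module _ (δ𝒪 : PDerivation 𝒪 p) where
    private module δ𝒪 = PDerivation δ𝒪

    record Isφ₀ (φ₀ : Carrier → Carrier) : Set (c ⊔ c′ ⊔ ℓ′) where
      field
        isFrobeniusLift : IsFrobeniusLift A p φ₀
        on-𝒪            : ∀ a → φ₀ (ι a) ≈ ι (δ𝒪.φ a)
        on-x            : ∀ j k → φ₀ (x j k) ≈ (x ⁽ p ⁾) j k

    record PAdicConnection : Set (c ⊔ c′ ⊔ ℓ′) where
      field
        pDerivation : PDerivation A p
      open PDerivation pDerivation public
      field
        on-𝒪 : ∀ a → δ (ι a) ≈ ι (δ𝒪.δ a)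

    IsMetric : O.Matrix n → PAdicConnection → Set (c ⊔ c′ ⊔ ℓ′)
    IsMetric q ∇ = ∃₂ λ ℋ φ₀ →
      Isℋ q ℋ × Isφ₀ φ₀ × (∀ a → ∇.φ (ℋ a) ≈ ℋ (φ₀ a))
      where module ∇ = PAdicConnection ∇

    Christoffel : (Fin n → O.Matrix n) → (Fin n → PAdicConnection) → Fin n → Matrix n
    Christoffel q ∇ i = (λ j k → ∇ᵢ.δ (x j k)) ᵗ · ιM (λ j k → δ𝒪.φ (q i j k)) · x ⁽ p ⁾
      where module ∇ᵢ = PAdicConnection (∇ i)

    record IsLeviCivita (q : Fin n → O.Matrix n) (∇ : Fin n → PAdicConnection) :
        Set (c ⊔ c′ ⊔ ℓ′) where
      field
        isMetric  : ∀ i → IsMetric (q i) (∇ i)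
        symmetric : ∀ i j k → Christoffel q ∇ i j k ≈ Christoffel q ∇ j i k

    module _ (pr : Prime p) where
      open ArithProperties A using (quotient; quotient*)

      divisible : ∀ (q : O.Matrix n) j k →
        num p ∣ (((x ᵗ · ιM q · x) ⁽ p ⁾) j k - ((x ⁽ p ⁾) ᵗ · (ιM q) ⁽ p ⁾ · x ⁽ p ⁾) j k)
      divisible q = PthPower.⁽⁾-·· A pr (x ᵗ) (ιM q) x

      opaque
        -- (1/p) {(xᵗ q x)⁽ᵖ⁾ - x⁽ᵖ⁾ᵗ q⁽ᵖ⁾ x⁽ᵖ⁾}
        defect : O.Matrix n → Matrix n
        defect q j k = quotient (divisible q j k)

        p*defect : ∀ q j k →
          defect q j k * num p
            ≈ ((x ᵗ · ιM q · x) ⁽ p ⁾) j k - ((x ⁽ p ⁾) ᵗ · (ιM q) ⁽ p ⁾ · x ⁽ p ⁾) j k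
        p*defect q j k = quotient* (divisible q j k)

      C-matrix : (Fin n → O.Matrix n) → Fin n → Matrix n
      C-matrix q i j k =
        - ((x ⁽ p ⁾) ᵗ · ιM (λ s t → δ𝒪.δ (q i s t)) · x ⁽ p ⁾) j k + defect (q i) j k

  p,x-1 : ⊤ ⊎ (Fin n × Fin n) → Carrier
  p,x-1 (inj₁ tt)      = num p
  p,x-1 (inj₂ (j , k)) = x j k - 𝟙 j k

module GL (𝒪 : CommutativeRing c ℓ) (p n : ℕ) where
  open Polynomial 𝒪 (n ℕ.* n) using (ring[]; const; var)

  det-x : CommutativeRing.Carrier ring[]
  det-x = Arith.det ring[] {n} (λ j k → var (combine j k))

  open Localization ring[] det-x
    using () renaming (localization to 𝒪[x,det⁻¹]; fromRing to toFraction) public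

  open Completion 𝒪[x,det⁻¹] (Arith.num 𝒪[x,det⁻¹] p)
    using () renaming (completion to 𝒪Ĝ; fromRing to toCompletion) public

  ι : CommutativeRing.Carrier 𝒪 → CommutativeRing.Carrier 𝒪Ĝ
  ι a = toCompletion (toFraction (const a))

  x : Arith.Matrix 𝒪Ĝ n
  x j k = toCompletion (toFraction (var (combine j k)))

{-# OPTIONS --safe #-}
module Submission where

-- Evaluating φᵢ ∘ ℋ = ℋ ∘ φ₀ at x gives φᵢ(x)ᵗ φ(qᵢ) φᵢ(x) = (xᵗ qᵢ x)⁽ᵖ⁾. Expanding
-- φᵢ(x) = x⁽ᵖ⁾ + p δᵢx and φ(qᵢ) = qᵢ⁽ᵖ⁾ + p δqᵢ and dividing by p, which is not a
-- zero divisor in 𝒪(Ĝ), gives Γᵢⱼₖ + Γᵢₖⱼ ≡ Cᵢⱼₖ mod p; together with Γᵢⱼₖ = Γⱼᵢₖ this is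
-- solved for Γ as in Koszul's formula. For the second congruence it remains to see
-- that the defect (1/p){(xᵗqx)⁽ᵖ⁾ - x⁽ᵖ⁾ᵗq⁽ᵖ⁾x⁽ᵖ⁾} lies in J = (p, x-1). This is done
-- without evaluating at x = 1: (a + b)ᵖ - aᵖ - bᵖ is a multiple of p a b, and in
-- the sums computing xᵗqx any product of two different terms has an off-diagonal
-- entry of x as a factor, so the numerator lies in p J.

open import Defs
open import Algebra.Bundles using (CommutativeRing)
import Algebra.Properties.Semiring.Sum as SemiringSum
import Algebra.Morphism.Construct.Composition as Composition
open import Algebra.Morphism.Structures using (module RingMorphisms)
open import Data.Fin.Base using (Fin; zero; suc; toℕ; fromℕ; inject₁)
import Data.Fin.Properties as Fin
open import Data.Nat.Base as ℕ using (ℕ; zero; suc; s≤s; z≤n; _≤_; _<_; _∸_)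
open import Data.Nat.Combinatorics using (nCn≡1) renaming (_C_ to _choose_)
open import Data.Nat.Divisibility using (_∣_; divides)
open import Data.Nat.Primality using (Prime; prime⇒nonZero)
import Data.Nat.Properties as ℕ
open import Data.Product.Base using (∃; _×_; _,_; proj₂)
open import Data.Sum.Base using (inj₁; inj₂)
open import Data.Unit.Base using (⊤; tt)
open import Data.Vec.Functional using (Vector)
open import Function.Base using (_∘_)
open import Level using (Level; _⊔_)
open import Relation.Binary.PropositionalEquality as ≡ using (_≡_; _≢_)
open import Relation.Nullary using (¬_; yes; no; contradiction)

private variable
  a c ℓ c′ ℓ′ c″ ℓ″ : Level

-- Ring homomorphisms

module _ (R : CommutativeRing c ℓ) (S : CommutativeRing c′ ℓ′) where
  private
    module R = CommutativeRing R
    module S = CommutativeRing S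

  ringHom : (f : R.Carrier → S.Carrier) →
            (∀ {x y} → x R.≈ y → f x S.≈ f y) →
            (∀ x y → f (x R.+ y) S.≈ f x S.+ f y) →
            (∀ x y → f (x R.* y) S.≈ f x S.* f y) →
            f R.0# S.≈ S.0# → f R.1# S.≈ S.1# →
            (∀ x → f (R.- x) S.≈ S.- f x) → IsRingHom R S f
  ringHom f cong + * 0# 1# neg = record
    { isSemiringHomomorphism = record
      { isNearSemiringHomomorphism = record
        { +-isMonoidHomomorphism = record
          { isMagmaHomomorphism = record
            { isRelHomomorphism = record { cong = cong }
            ; homo = +
            }
          ; ε-homo = 0#
          }
        ; *-homo = *
        }
      ; 1#-homo = 1#
      }
    ; -‿homo = neg
    }

IsRingHom-∘ : (R : CommutativeRing c ℓ) (S : CommutativeRing c′ ℓ′) (T : CommutativeRing c″ ℓ″) →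
              ∀ {f g} → IsRingHom S T g → IsRingHom R S f → IsRingHom R T (g ∘ f)
IsRingHom-∘ R S T g-hom f-hom =
  Composition.isRingHomomorphism (CommutativeRing.trans T) f-hom g-hom

-- Bilinear forms

module BilinearForm (R : CommutativeRing c ℓ) where
  open CommutativeRing R hiding (zero)
  open Arith R
  open import Algebra.Properties.Semiring.Sum semiring
    using (sum-cong-≋; ∑-distrib-+; ∑-comm; *-distribˡ-sum; *-distribʳ-sum; sum-replicate-zero)
  open import Relation.Binary.Reasoning.Setoid setoid
  open import Algebra.Solver.Ring.NaturalCoefficients.Default commutativeSemiring
    using (solve; _:=_; _:+_; _:*_)

  -- (Xᵗ · Q · Y) j k unfolds to the value of Q on column j of X and column k of Y.
  form : ∀ {n} → Matrix n → Vector Carrier n → Vector Carrier n → Carrier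
  form Q u v = sum (λ s → sum (λ r → u r * Q r s) * v s)

  private variable
    n : ℕ

  form-cong : ∀ {Q Q′ : Matrix n} {u u′ v v′} → (∀ r s → Q r s ≈ Q′ r s) →
              (∀ r → u r ≈ u′ r) → (∀ s → v s ≈ v′ s) → form Q u v ≈ form Q′ u′ v′
  form-cong Q≈ u≈ v≈ =
    sum-cong-≋ (λ s → *-cong (sum-cong-≋ (λ r → *-cong (u≈ r) (Q≈ r s))) (v≈ s))

  -- The two sums are interchanged. This carries `form-affineʳ` over to the left argument, and for
  -- symmetric `Q` it identifies the two cross terms of an expanded form.
  form-transpose : ∀ (Q : Matrix n) u v → form Q u v ≈ form (Q ᵗ) v u
  form-transpose Q u v = begin
    sum (λ s → sum (λ r → u r * Q r s) * v s)
      ≈⟨ sum-cong-≋ (λ s → *-distribʳ-sum (v s) (λ r → u r * Q r s)) ⟩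
    sum (λ s → sum (λ r → u r * Q r s * v s))
      ≈⟨ ∑-comm (λ s r → u r * Q r s * v s) ⟩
    sum (λ r → sum (λ s → u r * Q r s * v s))
      ≈⟨ sum-cong-≋ (λ r → sum-cong-≋ (λ s →
           solve 3 (λ u q v → u :* q :* v := v :* q :* u) refl (u r) (Q r s) (v s))) ⟩
    sum (λ r → sum (λ s → v s * Q r s * u r))
      ≈⟨ sum-cong-≋ (λ r → *-distribʳ-sum (u r) (λ s → v s * Q r s)) ⟨
    sum (λ r → sum (λ s → v s * Q r s) * u r)  ∎

  sum-affine : ∀ d (f g : Vector Carrier n) →
               sum (λ i → f i + d * g i) ≈ sum f + d * sum g
  sum-affine d f g = trans (∑-distrib-+ f (λ i → d * g i)) (+-congˡ (sym (*-distribˡ-sum d g)))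

  -- A Frobenius lift produces arguments of the shape `v + d * w`, with `d` the prime: φ(x) = x⁽ᵖ⁾ +
  -- p δx. The three affine laws expand such forms in powers of `d`.
  form-affineʳ : ∀ (Q : Matrix n) u d v w →
                 form Q u (λ s → v s + d * w s) ≈ form Q u v + d * form Q u w
  form-affineʳ Q u d v w = trans
    (sum-cong-≋ (λ s → solve 4 (λ a d v w → a :* (v :+ d :* w) := a :* v :+ d :* (a :* w))
      refl (uQ s) d (v s) (w s)))
    (sum-affine d (λ s → uQ s * v s) (λ s → uQ s * w s))
    where uQ = λ s → sum (λ r → u r * Q r s)

  form-affineˡ : ∀ (Q : Matrix n) d u w v →
                 form Q (λ r → u r + d * w r) v ≈ form Q u v + d * form Q w v
  form-affineˡ Q d u w v = begin
    form Q (λ r → u r + d * w r) v             ≈⟨ form-transpose Q _ v ⟩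
    form (Q ᵗ) v (λ r → u r + d * w r)         ≈⟨ form-affineʳ (Q ᵗ) v d u w ⟩
    form (Q ᵗ) v u + d * form (Q ᵗ) v w        ≈⟨ +-cong (form-transpose Q u v) (*-congˡ (form-transpose Q w v)) ⟨
    form Q u v + d * form Q w v                ∎

  form-affineᴹ : ∀ d (Q P : Matrix n) u v →
                 form (λ r s → Q r s + d * P r s) u v ≈ form Q u v + d * form P u v
  form-affineᴹ d Q P u v = trans
    (sum-cong-≋ (λ s → begin
      sum (λ r → u r * (Q r s + d * P r s)) * v s
        ≈⟨ *-congʳ (sum-cong-≋ (λ r →
             solve 4 (λ u q d p → u :* (q :+ d :* p) := u :* q :+ d :* (u :* p))
               refl (u r) (Q r s) d (P r s))) ⟩
      sum (λ r → u r * Q r s + d * (u r * P r s)) * v s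
        ≈⟨ *-congʳ (sum-affine d (λ r → u r * Q r s) (λ r → u r * P r s)) ⟩
      (uQ s + d * uP s) * v s
        ≈⟨ solve 4 (λ a d b v → (a :+ d :* b) :* v := a :* v :+ d :* (b :* v))
             refl (uQ s) d (uP s) (v s) ⟩
      uQ s * v s + d * (uP s * v s)  ∎))
    (sum-affine d (λ s → uQ s * v s) (λ s → uP s * v s))
    where
    uQ = λ s → sum (λ r → u r * Q r s)
    uP = λ s → sum (λ r → u r * P r s)

  sum-𝟙 : ∀ (f : Vector Carrier n) j → sum (λ r → 𝟙 r j * f r) ≈ f j
  sum-𝟙 {suc n} f zero    = trans
    (+-cong (*-identityˡ _) (trans (sum-cong-≋ (λ r → zeroˡ (f (suc r)))) (sum-replicate-zero n)))
    (+-identityʳ _)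
  sum-𝟙 {suc n} f (suc j) =
    trans (+-cong (zeroˡ _) (sum-𝟙 (f ∘ suc) j)) (+-identityˡ _)

  -- Evaluation on standard basis columns; it computes the quadratic term of C where x⁽ᵖ⁾ reduces to
  -- the identity.
  form-𝟙 : ∀ (Q : Matrix n) j k → form Q (λ r → 𝟙 r j) (λ s → 𝟙 s k) ≈ Q j k
  form-𝟙 Q j k = begin
    sum (λ s → sum (λ r → 𝟙 r j * Q r s) * 𝟙 s k)
      ≈⟨ sum-cong-≋ (λ s → trans (*-congʳ (sum-𝟙 (λ r → Q r s) j)) (*-comm (Q j s) (𝟙 s k))) ⟩
    sum (λ s → 𝟙 s k * Q j s)
      ≈⟨ sum-𝟙 (Q j) k ⟩
    Q j k  ∎

  𝟙-off-diagonal : ∀ {j k : Fin n} → j ≢ k → 𝟙 j k ≈ 0#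
  𝟙-off-diagonal {j = j} {k} j≢k with j Fin.≟ k
  ... | yes j≡k = contradiction j≡k j≢k
  ... | no  _   = refl

  -- The entries 0 and 1 are fixed by positive powers; exponent 0 would turn the off-diagonal
  -- entries into 1.
  𝟙-⁽⁾ : ∀ p .{{_ : ℕ.NonZero p}} (j k : Fin n) → (𝟙 ⁽ p ⁾) j k ≈ 𝟙 j k
  𝟙-⁽⁾ (suc p) j k with j Fin.≟ k
  ... | yes _ = 1^ (suc p)
    where
    1^ : ∀ m → 1# ^ m ≈ 1#
    1^ zero    = refl
    1^ (suc m) = trans (*-identityˡ _) (1^ m)
  ... | no  _ = zeroˡ _

module Homomorphism (R : CommutativeRing c ℓ) (S : CommutativeRing c′ ℓ′) where
  private
    module R where
      open CommutativeRing R public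
      open Arith R public
      open BilinearForm R public
    module S where
      open CommutativeRing S public
      open Arith S public
      open BilinearForm S public
      open import Algebra.Properties.Semiring.Sum semiring public using (sum-cong-≋)

  module _ {f : R.Carrier → S.Carrier} (hom : IsRingHom R S f) where
    open RingMorphisms.IsRingHomomorphism hom

    ^-homo : ∀ x m → f (x R.^ m) S.≈ f x S.^ m
    ^-homo x zero    = 1#-homo
    ^-homo x (suc m) = S.trans (*-homo x _) (S.*-congˡ (^-homo x m))

    num-homo : ∀ m → f (R.num m) S.≈ S.num m
    num-homo zero    = 0#-homo
    num-homo (suc m) = S.trans (+-homo _ _) (S.+-cong 1#-homo (num-homo m))

    sum-homo : ∀ {n} (g : Vector R.Carrier n) → f (R.sum g) S.≈ S.sum (f ∘ g)
    sum-homo {zero}  g = 0#-homo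
    sum-homo {suc n} g = S.trans (+-homo _ _) (S.+-congˡ (sum-homo (g ∘ suc)))

    form-homo : ∀ {n} (Q : R.Matrix n) u v →
                f (R.form Q u v) S.≈ S.form (λ r s → f (Q r s)) (f ∘ u) (f ∘ v)
    form-homo Q u v = S.trans (sum-homo (λ s → uQ s R.* v s)) (S.sum-cong-≋ (λ s →
      S.trans (*-homo (uQ s) (v s)) (S.*-congʳ
        (S.trans (sum-homo (λ r → u r R.* Q r s)) (S.sum-cong-≋ (λ r → *-homo (u r) (Q r s)))))))
      where uQ = λ s → R.sum (λ r → u r R.* Q r s)

-- Quotients by ideals

module _ (R : CommutativeRing c ℓ) where
  open CommutativeRing R hiding (zero)
  open Arith R using (Ideal; generator; 0∈; +-closed; *-closed; resp-≈; _^_) renaming (_∣_ to _∣ᴿ_)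
  open ArithProperties R

  module _ {I : Set a} {g : I → Carrier} where

    Ideal-neg : ∀ {x} → Ideal g x → Ideal g (- x)
    Ideal-neg {x} x∈ = resp-≈ (-1*x≈-x x) (*-closed (- 1#) x∈)

    Ideal-resp-∼ : ∀ {x y} → Ideal g (x - y) → Ideal g y → Ideal g x
    Ideal-resp-∼ {x} {y} x∼y y∈ = resp-≈
      (trans (+-assoc x (- y) y) (trans (+-congˡ (-‿inverseˡ y)) (+-identityʳ x)))
      (+-closed x∼y y∈)

    Ideal-∣ : ∀ i {x} → g i ∣ᴿ x → Ideal g x
    Ideal-∣ i (q , e) = resp-≈ e (*-closed q (generator i))

    -- Together with `Ideal-unscale`, this says that the generators `d * g i` present the ideal d I,
    -- which serves below as the modulus p I.
    Ideal-scale : ∀ d {x} → Ideal g x → Ideal (λ i → d * g i) (d * x)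
    Ideal-scale d (generator i)   = generator i
    Ideal-scale d 0∈              = resp-≈ (sym (zeroʳ d)) 0∈
    Ideal-scale d (+-closed x∈ y∈) =
      resp-≈ (sym (distribˡ d _ _)) (+-closed (Ideal-scale d x∈) (Ideal-scale d y∈))
    Ideal-scale d (*-closed r {x} x∈) = resp-≈
      (trans (sym (*-assoc r d x)) (trans (*-congʳ (*-comm r d)) (*-assoc d r x)))
      (*-closed r (Ideal-scale d x∈))
    Ideal-scale d (resp-≈ e x∈)   = resp-≈ (*-congˡ e) (Ideal-scale d x∈)

    -- The cofactor `y` is built along the derivation of membership. It is one possible quotient by
    -- `d`, and the only one when `d` is torsion free.
    Ideal-unscale : ∀ d {x} → Ideal (λ i → d * g i) x → ∃ λ y → Ideal g y × d * y ≈ x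
    Ideal-unscale d (generator i) = g i , generator i , refl
    Ideal-unscale d 0∈            = 0# , 0∈ , zeroʳ d
    Ideal-unscale d (+-closed x∈ x′∈) =
      let y , y∈ , e = Ideal-unscale d x∈; y′ , y′∈ , e′ = Ideal-unscale d x′∈
      in y + y′ , +-closed y∈ y′∈ , trans (distribˡ d y y′) (+-cong e e′)
    Ideal-unscale d (*-closed r x∈) =
      let y , y∈ , e = Ideal-unscale d x∈
      in r * y , *-closed r y∈ ,
         trans (sym (*-assoc d r y)) (trans (*-congʳ (*-comm d r)) (trans (*-assoc r d y) (*-congˡ e)))
    Ideal-unscale d (resp-≈ e x∈) =
      let y , y∈ , e′ = Ideal-unscale d x∈ in y , y∈ , trans e′ e

  -- A one-element family, so that congruence modulo `d` becomes equality in a `quotientRing`.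
  principal : Carrier → ⊤ → Carrier
  principal d _ = d

  Ideal-principal : ∀ {d x} → Ideal (principal d) x → d ∣ᴿ x
  Ideal-principal (generator _)    = 1# , *-identityˡ _
  Ideal-principal 0∈               = ∣-0
  Ideal-principal (+-closed x∈ y∈) = ∣-+ (Ideal-principal x∈) (Ideal-principal y∈)
  Ideal-principal (*-closed r x∈)  = ∣-* r (Ideal-principal x∈)
  Ideal-principal (resp-≈ e x∈)    = ∣-resp e (Ideal-principal x∈)

  module _ {I : Set a} (g : I → Carrier) where
    private
      infix 4 _∼_
      _∼_ : Carrier → Carrier → Set _
      x ∼ y = Ideal g (x - y)

    ≈⇒∼ : ∀ {x y} → x ≈ y → x ∼ y
    ≈⇒∼ x≈y = resp-≈ (sym (x≈y⇒x∙y⁻¹≈ε x≈y)) 0∈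

    private
      ∼-sym : ∀ {x y} → x ∼ y → y ∼ x
      ∼-sym {x} {y} h = resp-≈ (⁻¹-anti-homo-// x y) (Ideal-neg h)

      ∼-trans : ∀ {x y z} → x ∼ y → y ∼ z → x ∼ z
      ∼-trans h k = resp-≈ (telescope _ _ _) (+-closed h k)

      ∼-*ˡ : ∀ r {x y} → x ∼ y → r * x ∼ r * y
      ∼-*ˡ r h = resp-≈ (x[y-z]≈xy-xz r _ _) (*-closed r h)

    -- Only the equality changes, so elements need no projection, and any lemma about commutative
    -- rings, read here, is a lemma about congruences.
    quotientRing : CommutativeRing c (a ⊔ c ⊔ ℓ)
    quotientRing = record
      { Carrier = Carrier
      ; _≈_ = _∼_
      ; _+_ = _+_
      ; _*_ = _*_
      ; -_  = -_
      ; 0#  = 0#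
      ; 1#  = 1#
      ; isCommutativeRing = record
        { isRing = record
          { +-isAbelianGroup = record
            { isGroup = record
              { isMonoid = record
                { isSemigroup = record
                  { isMagma = record
                    { isEquivalence = record
                      { refl = ≈⇒∼ refl ; sym = ∼-sym ; trans = ∼-trans }
                    ; ∙-cong = λ h k → resp-≈ (interchange _ _ _ _) (+-closed h k)
                    }
                  ; assoc = λ x y z → ≈⇒∼ (+-assoc x y z)
                  }
                ; identity = (λ x → ≈⇒∼ (+-identityˡ x)) , (λ x → ≈⇒∼ (+-identityʳ x))
                }
              ; inverse = (λ x → ≈⇒∼ (-‿inverseˡ x)) , (λ x → ≈⇒∼ (-‿inverseʳ x))
              ; ⁻¹-cong = λ {x} {y} h → resp-≈ (sym (⁻¹-∙-comm x (- y))) (Ideal-neg h)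
              }
            ; comm = λ x y → ≈⇒∼ (+-comm x y)
            }
          ; *-cong = λ {x} {y} {z} {w} h k → ∼-trans (∼-*ˡ x k)
              (∼-trans (≈⇒∼ (*-comm x w)) (∼-trans (∼-*ˡ w h) (≈⇒∼ (*-comm w y))))
          ; *-assoc = λ x y z → ≈⇒∼ (*-assoc x y z)
          ; *-identity = (λ x → ≈⇒∼ (*-identityˡ x)) , (λ x → ≈⇒∼ (*-identityʳ x))
          ; distrib = (λ x y z → ≈⇒∼ (distribˡ x y z)) , (λ x y z → ≈⇒∼ (distribʳ x y z))
          }
        ; *-comm = λ x y → ≈⇒∼ (*-comm x y)
        }
      }

    -- Not an instance of a stdlib lemma at the quotient: _^_ takes the raw ring,
    -- equality included, as a parameter, so the powers of the two rings differ.
    mod-^ : ∀ m {x y} → x ∼ y → x ^ m ∼ y ^ m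
    mod-^ zero    h = ≈⇒∼ refl
    mod-^ (suc m) h = CommutativeRing.*-cong quotientRing h (mod-^ m h)

-- Torsion-freeness

module _ (R : CommutativeRing c ℓ) where
  open CommutativeRing R hiding (zero)
  open ArithProperties R

  TorsionFree : Carrier → Set (c ⊔ ℓ)
  TorsionFree d = ∀ x → d * x ≈ 0# → x ≈ 0#

  module _ {d : Carrier} (tf : TorsionFree d) where

    TorsionFree-resp : ∀ {e} → d ≈ e → TorsionFree e
    TorsionFree-resp d≈e x ex≈0 = tf x (trans (*-congʳ d≈e) ex≈0)

    TorsionFree-cancel : ∀ x y → d * x ≈ d * y → x ≈ y
    TorsionFree-cancel x y e =
      x∙y⁻¹≈ε⇒x≈y x y (tf (x - y) (trans (x[y-z]≈xy-xz d x y) (x≈y⇒x∙y⁻¹≈ε e)))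

module _ (R : CommutativeRing c ℓ) (m : ℕ) where
  open CommutativeRing R hiding (zero)
  open Polynomial R m

  const-isRingHom : IsRingHom R ring[] const
  const-isRingHom = ringHom R ring[] const
    (λ e → coeffwise λ _ → +-congʳ (*-congʳ e))
    (λ a b → coeffwise λ _ → trans (+-congʳ (distribʳ _ a b))
      (trans (+-assoc _ _ _) refl))
    (λ a b → coeffwise λ μ → +-congʳ (*-congˡ (reflexive
      (≡.cong (indicator μ) (≡.sym (∙-identityˡ ε))))))
    (coeffwise λ _ → trans (+-identityʳ _) (zeroˡ _))
    (coeffwise λ _ → refl)
    (λ _ → coeffwise λ _ → refl)

  -- Multiplication by `const d` multiplies every coefficient by `d`.
  const-torsionFree : ∀ {d} → TorsionFree R d → TorsionFree ring[] (const d)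
  const-torsionFree {d} tf f df≋0 = coeffwise λ μ → tf (coeff μ f) (begin
    d * coeff μ f                              ≈⟨ *-congˡ (pair-cong (λ ρ →
                                                    reflexive (≡.cong (indicator μ) (∙-identityˡ ρ))) f) ⟨
    d * pair (λ ρ → indicator μ (ε ∙ ρ)) f     ≈⟨ +-identityʳ _ ⟨
    d * pair (λ ρ → indicator μ (ε ∙ ρ)) f + 0# ≈⟨ pair-⊛ _ (const d) f ⟨
    coeff μ (const d ⊛ f)                      ≈⟨ at df≋0 μ ⟩
    0#                                         ∎)
    where open import Relation.Binary.Reasoning.Setoid setoid

module _ (R : CommutativeRing c ℓ) (s : CommutativeRing.Carrier R) where
  open CommutativeRing R hiding (zero)
  open Arith R using (_^_)
  open Localization R s
  open import Relation.Binary.Reasoning.Setoid setoid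
  open import Algebra.Solver.Ring.NaturalCoefficients.Default commutativeSemiring
    using (solve; _:=_; _:+_; _:*_; con)

  toLocalization-isRingHom : IsRingHom R localization fromRing
  toLocalization-isRingHom = ringHom R localization fromRing
    (λ e → exact (*-congʳ e))
    (λ a b → exact (solve 2 (λ a b → (a :+ b) :* (con 1 :* con 1)
                                  := (a :* con 1 :+ b :* con 1) :* con 1) refl a b))
    (λ a b → exact (solve 2 (λ a b → (a :* b) :* (con 1 :* con 1) := (a :* b) :* con 1) refl a b))
    (exact refl)
    (exact refl)
    (λ _ → exact refl)

  -- The power of `s` that kills `d * f` also kills `f`, by cancelling `d` in the equation that
  -- witnesses it.
  localization-torsionFree : ∀ {d} → TorsionFree R d → TorsionFree localization (fromRing d)
  localization-torsionFree {d} tf F (k witnesses e) = k witnesses (begin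
    s ^ k * (f * 1#)          ≈⟨ tf _ (begin
      d * (s ^ k * (f * 1#))    ≈⟨ solve 3 (λ d u f → d :* (u :* (f :* con 1)) := u :* (d :* f :* con 1))
                                     refl d (s ^ k) f ⟩
      s ^ k * (d * f * 1#)      ≈⟨ e ⟩
      s ^ k * (0# * (1# * t))   ≈⟨ trans (*-congˡ (zeroˡ _)) (zeroʳ _) ⟩
      0#                        ∎) ⟩
    0#                        ≈⟨ trans (*-congˡ (zeroˡ _)) (zeroʳ _) ⟨
    s ^ k * (0# * t)          ∎)
    where
    open Fraction F using () renaming (numer to f; denom to t)

module _ (R : CommutativeRing c ℓ) (d : CommutativeRing.Carrier R) where
  open CommutativeRing R hiding (zero)
  open Arith R using (_^_)
  open ArithProperties R
  open Completion R d
  open import Relation.Binary.Reasoning.Setoid setoid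

  toCompletion-isRingHom : IsRingHom R completion fromRing
  toCompletion-isRingHom = ringHom R completion fromRing
    (λ e → pointwise λ _ → e)
    (λ _ _ → pointwise λ _ → refl)
    (λ _ _ → pointwise λ _ → refl)
    (pointwise λ _ → refl)
    (pointwise λ _ → refl)
    (λ _ → pointwise λ _ → refl)

  -- d u = 0 at level n + 1 gives u = 0 only at level n, which suffices by coherence.
  completion-torsionFree : TorsionFree R d → TorsionFree completion (fromRing d)
  completion-torsionFree tf u du≅0 = termwise λ n →
    let w , e = at du≅0 (suc n) in
    mod-trans (mod-sym (step u n))
      (∣-resp (sym (trans (+-congˡ -0#≈0#) (+-identityʳ _)))
        (w , TorsionFree-cancel R tf (w * d ^ n) (seq u (suc n)) (begin
          d * (w * d ^ n)          ≈⟨ *-assoc d w (d ^ n) ⟨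
          d * w * d ^ n            ≈⟨ *-congʳ (*-comm d w) ⟩
          w * d * d ^ n            ≈⟨ *-assoc w d (d ^ n) ⟩
          w * (d * d ^ n)          ≈⟨ e ⟩
          d * seq u (suc n) - 0#   ≈⟨ trans (+-congˡ -0#≈0#) (+-identityʳ _) ⟩
          d * seq u (suc n)        ∎)))

-- Frobenius modulo p I

module _ (R : CommutativeRing c ℓ) {p : ℕ} (pr : Prime p) where
  open CommutativeRing R hiding (zero)
  open Arith R renaming (_∣_ to _∣ᴿ_)
  open ArithProperties R
  open import Algebra.Properties.CommutativeSemiring.Binomial commutativeSemiring
    using (binomialTerm; theorem)
  open import Algebra.Solver.Ring.NaturalCoefficients.Default commutativeSemiring
    using (solve; _:=_; _:+_; _:*_)
  open import Relation.Binary.Reasoning.Setoid setoid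

  ∣-sum : ∀ {d n} (f : Vector Carrier n) → (∀ i → d ∣ᴿ f i) → d ∣ᴿ sum f
  ∣-sum {n = zero}  f d∣f = ∣-0
  ∣-sum {n = suc n} f d∣f = ∣-+ (d∣f zero) (∣-sum (f ∘ suc) (d∣f ∘ suc))

  -- The mixed binomial terms are divisible by x y as well as by p.
  ^p-+ : ∀ x y → (x + y) ^ p ≡ x ^ p + y ^ p [mod num p * (x * y) ]
  ^p-+ x y = go p ≡.refl
    where
    -- `p` is a fixed parameter, so its successor form is obtained by matching on an equation.
    go : ∀ m → m ≡ p → (x + y) ^ p ≡ x ^ p + y ^ p [mod num p * (x * y) ]
    go zero    ≡.refl = contradiction ≡.refl (ℕ.≢-nonZero⁻¹ 0 {{prime⇒nonZero pr}})
    go (suc m) ≡.refl = ∣-resp eq (∣-sum mixed mixed∣)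
      where
      T     = binomialTerm x y (suc m)
      mixed = λ (i : Fin m) → T (suc (inject₁ i))

      term∣ : ∀ {b} k l → p ∣ b → num p * (x * y) ∣ᴿ (b • (x ^ suc k * y ^ suc l))
      term∣ k l (divides e ≡.refl) = num e * (x ^ k * y ^ l) , (begin
        num e * (x ^ k * y ^ l) * (num p * (x * y))
          ≈⟨ solve 6 (λ e u v p x y → e :* (u :* v) :* (p :* (x :* y))
                                   := e :* p :* (x :* u :* (y :* v)))
               refl (num e) (x ^ k) (y ^ l) (num p) x y ⟩
        num e * num p * (x ^ suc k * y ^ suc l)
          ≈⟨ *-congʳ (×1-homo-* e p) ⟨
        num (e ℕ.* p) * (x ^ suc k * y ^ suc l)
          ≈⟨ trans (×-assoc-* (e ℕ.* p) 1# _) (×-congʳ (e ℕ.* p) (*-identityˡ _)) ⟩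
        (e ℕ.* p) • (x ^ suc k * y ^ suc l)  ∎)

      mixed∣ : ∀ i → num p * (x * y) ∣ᴿ mixed i
      -- The exponent of `y` is p - (k + 1), positive because `k < m`; rewriting it as a successor
      -- exposes the factor `y`.
      mixed∣ i = ≡.subst (λ l → num p * (x * y) ∣ᴿ ((p choose suc k) • (x ^ suc k * y ^ l)))
        (≡.sym (ℕ.+-∸-assoc 1 k<m))
        (term∣ k (m ∸ suc k) (∣C pr (suc k) (s≤s z≤n) (s≤s k<m)))
        where
        k   = toℕ (inject₁ i)
        k<m = ≡.subst (_< m) (≡.sym (Fin.toℕ-inject₁ i)) (Fin.toℕ<n i)

      first : T zero ≈ y ^ p
      first = trans (+-identityʳ _) (*-identityˡ _)

      last : T (suc (fromℕ m)) ≈ x ^ p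
      last = begin
        (p choose suc k) • (x ^ suc k * y ^ (m ∸ k))
          ≡⟨ ≡.cong (λ k → (p choose suc k) • (x ^ suc k * y ^ (m ∸ k))) (Fin.toℕ-fromℕ m) ⟩
        (p choose p) • (x ^ p * y ^ (m ∸ m))
          ≡⟨ ≡.cong₂ (λ a b → a • (x ^ p * y ^ b)) (nCn≡1 p) (ℕ.n∸n≡0 m) ⟩
        1 • (x ^ p * 1#)
          ≈⟨ trans (+-identityʳ _) (*-identityʳ _) ⟩
        x ^ p  ∎
        where k = toℕ (fromℕ m)

      eq : sum mixed ≈ (x + y) ^ p - (x ^ p + y ^ p)
      eq = sym (begin
        (x + y) ^ p - (x ^ p + y ^ p)
          ≈⟨ +-congʳ (theorem p x y) ⟩
        (T zero + sum (T ∘ suc)) - (x ^ p + y ^ p)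
          ≈⟨ +-congʳ (+-cong first (trans (sum-init-last (T ∘ suc)) (+-congˡ last))) ⟩
        (y ^ p + (sum mixed + x ^ p)) - (x ^ p + y ^ p)
          ≈⟨ +-congʳ (solve 3 (λ u v s → v :+ (s :+ u) := (u :+ v) :+ s) refl (x ^ p) (y ^ p) _) ⟩
        ((x ^ p + y ^ p) + sum mixed) - (x ^ p + y ^ p)
          ≈⟨ xyx⁻¹≈y _ _ ⟩
        sum mixed  ∎)

  module _ {I : Set a} (g : I → Carrier) where
    private
      pI = λ i → num p * g i
      module Q = CommutativeRing (quotientRing R pI)
      module QSum = SemiringSum Q.semiring

    open import Algebra.Properties.CommutativeSemiring.Exp commutativeSemiring
      using (^-distrib-*)
    open import Algebra.Properties.Semiring.Sum semiring using (*-distribˡ-sum)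

    Ideal-sum : ∀ {n} (f : Vector Carrier n) → (∀ i → Ideal g (f i)) → Ideal g (sum f)
    Ideal-sum {zero}  f f∈ = 0∈
    Ideal-sum {suc n} f f∈ = +-closed (f∈ zero) (Ideal-sum (f ∘ suc) (f∈ ∘ suc))

    -- Splitting off `f zero` costs a multiple of p times `f zero * sum (f ∘ suc)`, by `^p-+`.
    -- Distributing turns this product into a sum of products of different terms, all in I.
    ^p-sum : ∀ {n} (f : Vector Carrier n) → (∀ i j → i ≢ j → Ideal g (f i * f j)) →
             sum f ^ p ≡ sum (λ i → f i ^ p) [mod⟨ pI ⟩]
    ^p-sum {zero}  f f∈ = ≈⇒∼ R pI (0^ p {{prime⇒nonZero pr}})
      where
      0^ : ∀ m .{{_ : ℕ.NonZero m}} → 0# ^ m ≈ 0#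
      0^ (suc m) = zeroˡ _
    ^p-sum {suc n} f f∈ = Q.trans
      (p∣⇒ (^p-+ (f zero) (sum (f ∘ suc))))
      (Q.+-congˡ {f zero ^ p} (^p-sum (f ∘ suc) (λ i j i≢j → f∈ (suc i) (suc j) (i≢j ∘ Fin.suc-injective))))
      where
      mixed∈ : Ideal g (f zero * sum (f ∘ suc))
      mixed∈ = resp-≈ (sym (*-distribˡ-sum (f zero) (f ∘ suc)))
        (Ideal-sum _ (λ i → f∈ zero (suc i) (λ ())))
      p∣⇒ : ∀ {z} → num p * (f zero * sum (f ∘ suc)) ∣ᴿ z → Ideal pI z
      p∣⇒ (e , eq) = resp-≈ eq (*-closed e (Ideal-scale R (num p) mixed∈))

    module _ {n} {A : Matrix n} where

      -- Two different terms of the sum contain `A j r` and `A j s` with `r ≢ s`. At most one of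
      -- these is diagonal, so their product lies in I.
      ⁽p⁾-·ˡ : (∀ r s → r ≢ s → Ideal g (A r s)) → ∀ (B : Matrix n) j k →
               ((A · B) ⁽ p ⁾) j k ≡ (A ⁽ p ⁾ · B ⁽ p ⁾) j k [mod⟨ pI ⟩]
      ⁽p⁾-·ˡ A∈ B j k = Q.trans
        (^p-sum (λ s → A j s * B s k) f∈)
        (≈⇒∼ R pI (sum-cong-≋ (λ s → ^-distrib-* (A j s) (B s k) p)))
        where
        f∈ : ∀ r s → r ≢ s → Ideal g (A j r * B r k * (A j s * B s k))
        f∈ r s r≢s with j Fin.≟ r
        ... | yes ≡.refl = *-closed _ (resp-≈ (*-comm _ _) (*-closed (B s k) (A∈ j s r≢s)))
        ... | no  j≢r    = resp-≈
          (solve 3 (λ a b c → b :* c :* a := a :* b :* c) refl (A j r) (B r k) _)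
          (*-closed (B r k * (A j s * B s k)) (A∈ j r j≢r))

      ⁽p⁾-·ʳ : (∀ r s → r ≢ s → Ideal g (A r s)) → ∀ (B : Matrix n) j k →
               ((B · A) ⁽ p ⁾) j k ≡ (B ⁽ p ⁾ · A ⁽ p ⁾) j k [mod⟨ pI ⟩]
      ⁽p⁾-·ʳ A∈ B j k = Q.trans
        (^p-sum (λ s → B j s * A s k) f∈)
        (≈⇒∼ R pI (sum-cong-≋ (λ s → ^-distrib-* (B j s) (A s k) p)))
        where
        f∈ : ∀ r s → r ≢ s → Ideal g (B j r * A r k * (B j s * A s k))
        f∈ r s r≢s with r Fin.≟ k
        ... | yes ≡.refl = *-closed _ (*-closed (B j s) (A∈ s r (r≢s ∘ ≡.sym)))
        ... | no  r≢k    = resp-≈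
          (solve 3 (λ a b c → c :* (b :* a) := b :* a :* c) refl (A r k) (B j r) _)
          (*-closed (B j s * A s k) (*-closed (B j r) (A∈ r k r≢k)))

    -- `PthPower.⁽⁾-··` gives this congruence modulo p for arbitrary factors. The additional factor
    -- I is what remains after dividing by p.
    ⁽p⁾-ᵗ·· : ∀ {n} {A : Matrix n} → (∀ r s → r ≢ s → Ideal g (A r s)) → ∀ (B : Matrix n) j k →
              ((A ᵗ · B · A) ⁽ p ⁾) j k ≡ ((A ⁽ p ⁾) ᵗ · B ⁽ p ⁾ · A ⁽ p ⁾) j k [mod⟨ pI ⟩]
    ⁽p⁾-ᵗ·· {A = A} A∈ B j k = Q.trans
      (⁽p⁾-·ʳ A∈ (A ᵗ · B) j k)
      (QSum.sum-cong-≋ {x = λ s → ((A ᵗ · B) ⁽ p ⁾) j s * A s k ^ p}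
                    {y = λ s → ((A ⁽ p ⁾) ᵗ · B ⁽ p ⁾) j s * A s k ^ p}
        (λ s → Q.*-congʳ {A s k ^ p} (⁽p⁾-·ˡ (λ r s r≢s → A∈ s r (r≢s ∘ ≡.sym)) B j s)))

-- Koszul's formula

module _ (R : CommutativeRing c ℓ) where
  open CommutativeRing R hiding (zero)
  open Arith R using (num)
  open ArithProperties R
  open import Relation.Binary.Reasoning.Setoid setoid
  open import Algebra.Solver.Ring.NaturalCoefficients.Default commutativeSemiring
    using (solve; _:=_; _:+_; _:*_; con)

  -- In κ i j k + κ j i k - κ k i j, symmetry in the first two indices cancels γ i k j against γ k i
  -- j and γ j k i against γ k j i, leaving 2 γ i j k. An arbitrary ring is allowed so that the
  -- formula can be used modulo p.
  koszul : {I : Set a} (γ κ : I → I → I → Carrier) →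
           (∀ i j k → γ i j k + γ i k j ≈ κ i j k) →
           (∀ i j k → γ i j k ≈ γ j i k) →
           ∀ {h} → h * num 2 ≈ 1# →
           ∀ i j k → γ i j k ≈ h * (κ i j k + κ j i k - κ k i j)
  koszul γ κ γ+γ γ-sym {h} h*2 i j k = begin
    γ i j k                                  ≈⟨ *-identityˡ _ ⟨
    1# * γ i j k                             ≈⟨ *-congʳ h*2 ⟨
    h * num 2 * γ i j k                      ≈⟨ *-assoc _ _ _ ⟩
    h * (num 2 * γ i j k)                    ≈⟨ *-congˡ (xyx⁻¹≈y (κ k i j) _) ⟨
    h * (κ k i j + num 2 * γ i j k - κ k i j) ≈⟨ *-congˡ (+-congʳ eq) ⟩
    h * (κ i j k + κ j i k - κ k i j)        ∎
    where
    eq : κ k i j + num 2 * γ i j k ≈ κ i j k + κ j i k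
    eq = begin
      κ k i j + num 2 * γ i j k                        ≈⟨ +-congʳ (γ+γ k i j) ⟨
      γ k i j + γ k j i + num 2 * γ i j k              ≈⟨ +-congʳ (+-cong (γ-sym k i j) (γ-sym k j i)) ⟩
      γ i k j + γ j k i + num 2 * γ i j k
        -- The coefficient of `e` is `num 2` unfolded.
        ≈⟨ solve 3 (λ a b e → a :+ b :+ (con 1 :+ (con 1 :+ con 0)) :* e := (e :+ a) :+ (e :+ b))
             refl (γ i k j) (γ j k i) (γ i j k) ⟩
      (γ i j k + γ i k j) + (γ i j k + γ j k i)        ≈⟨ +-cong (γ+γ i j k) (+-congʳ (γ-sym i j k)) ⟩
      κ i j k + (γ j i k + γ j k i)                    ≈⟨ +-congˡ (γ+γ j i k) ⟩
      κ i j k + κ j i k                                ∎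

-- Christoffel symbols of a metric connection

module _ (𝒪 : CommutativeRing c ℓ) (A : CommutativeRing c′ ℓ′)
    {ι : CommutativeRing.Carrier 𝒪 → CommutativeRing.Carrier A} (ι-hom : IsRingHom 𝒪 A ι)
    {p : ℕ} (pr : Prime p) (tf : TorsionFree A (Arith.num A p))
    {n : ℕ} (x : Arith.Matrix A n) (δ𝒪 : PDerivation 𝒪 p) where
  open CommutativeRing A hiding (zero)
  open Arith A hiding (_∣_)
  open ArithProperties A
  open BilinearForm A
  open Connections 𝒪 A ι p x
  open import Relation.Binary.Reasoning.Setoid setoid
  open import Algebra.Solver.Ring.NaturalCoefficients.Default commutativeSemiring
    using (solve; _:=_; _:+_; _:*_)
  private
    module O   = CommutativeRing 𝒪
    module δ𝒪  = PDerivation δ𝒪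
    module ι   = RingMorphisms.IsRingHomomorphism ι-hom
    module Hom = Homomorphism

    X = x ⁽ p ⁾
    π = num p

    ιq⁽p⁾ ιδ ιφ : Arith.Matrix 𝒪 n → Matrix n
    ιq⁽p⁾ q r s = ι (q r s) ^ p
    ιδ    q r s = ι (δ𝒪.δ (q r s))
    ιφ    q r s = ι (δ𝒪.φ (q r s))

    column : Matrix n → Fin n → Vector Carrier n
    column B k s = B s k

  ι-φ : ∀ a → ι (δ𝒪.φ a) ≈ ι a ^ p + π * ι (δ𝒪.δ a)
  ι-φ a = trans (ι.+-homo _ _) (+-cong (Hom.^-homo 𝒪 A ι-hom a p)
    (trans (ι.*-homo _ _) (*-congʳ (Hom.num-homo 𝒪 A ι-hom p))))

  module _ (q : Arith.Matrix 𝒪 n) (∇ : PAdicConnection δ𝒪) where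
    private module ∇ = PAdicConnection ∇

    -- The metric condition is read at `x j k`: on one side φ passes through the form xᵗqx, on the
    -- other `ℋ` passes through the power `x j k ^ p`.
    metric-equation : IsMetric δ𝒪 q ∇ → ∀ j k →
      form (ιφ q) (λ r → ∇.φ (x r j)) (λ s → ∇.φ (x s k)) ≈ ((x ᵗ · ιM q · x) ⁽ p ⁾) j k
    metric-equation (ℋ , φ₀ , isℋ , isφ₀ , φℋ≈ℋφ₀) j k = begin
      form (ιφ q) (λ r → ∇.φ (x r j)) (λ s → ∇.φ (x s k))
        -- Since the connection extends δ, its Frobenius lift agrees with that of 𝒪 on the entries
        -- of `q`.
        ≈⟨ form-cong (λ r s → trans (ι-φ (q r s)) (+-congˡ (*-congˡ (sym (∇.on-𝒪 (q r s))))))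
             (λ _ → refl) (λ _ → refl) ⟩
      form (λ r s → ∇.φ (ι (q r s))) (λ r → ∇.φ (x r j)) (λ s → ∇.φ (x s k))
        ≈⟨ Hom.form-homo A A ∇.isRingHom (ιM q) (column x j) (column x k) ⟨
      ∇.φ (form (ιM q) (column x j) (column x k))
        ≈⟨ φ.⟦⟧-cong (ℋ.on-x j k) ⟨
      ∇.φ (ℋ (x j k))            ≈⟨ φℋ≈ℋφ₀ (x j k) ⟩
      ℋ (φ₀ (x j k))             ≈⟨ ℋhom.⟦⟧-cong (φ₀.on-x j k) ⟩
      ℋ (x j k ^ p)              ≈⟨ Hom.^-homo A A ℋ.isRingHom (x j k) p ⟩
      ℋ (x j k) ^ p              ≈⟨ ^-congˡ p (ℋ.on-x j k) ⟩
      ((x ᵗ · ιM q · x) ⁽ p ⁾) j k  ∎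
      where
      module φ    = RingMorphisms.IsRingHomomorphism ∇.isRingHom
      module ℋ    = Isℋ isℋ
      module ℋhom = RingMorphisms.IsRingHomomorphism ℋ.isRingHom
      module φ₀   = Isφ₀ isφ₀

    -- The metric equation is expanded with φ(x) = `X + π * D`. The terms linear in `D` are p Γ j k
    -- and p Γ k j, the quadratic one is p² E. After one p is cancelled, the error in the congruence
    -- is exactly -p E.
    christoffel-+-transpose : Arith.IsSymmetric 𝒪 q → IsMetric δ𝒪 q ∇ →
      let D = λ r j → ∇.δ (x r j)
          Γ = D ᵗ · ιφ q · X in
      ∀ j k →
      Γ j k + Γ k j
        ≡ - (X ᵗ · ιδ q · X) j k + defect δ𝒪 pr q j k [mod π ]
    christoffel-+-transpose q-sym metric j k = ∣-resp eq (∣-neg (E , *-comm E π))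
      where
      D  = λ r j → ∇.δ (x r j)
      Γ  = D ᵗ · ιφ q · X
      Xⱼ = column X j
      Xₖ = column X k
      Dⱼ = column D j
      Dₖ = column D k
      E  = form (ιφ q) Dⱼ Dₖ
      Q₁ = form (ιδ q) Xⱼ Xₖ
      Q₀ = form (ιq⁽p⁾ q) Xⱼ Xₖ
      d  = defect δ𝒪 pr q j k

      φq-sym : ∀ r s → ιφ q s r ≈ ιφ q r s
      φq-sym r s = ι.⟦⟧-cong (φ.⟦⟧-cong (q-sym s r))
        where module φ = RingMorphisms.IsRingHomomorphism δ𝒪.isRingHom

      expand : form (ιφ q) (λ r → X r j + π * D r j) (λ s → X s k + π * D s k)
                 ≈ (Q₀ + π * Q₁ + π * Γ k j) + π * (Γ j k + π * E)
      expand = begin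
        form (ιφ q) (λ r → X r j + π * D r j) (λ s → X s k + π * D s k)
          ≈⟨ form-affineˡ (ιφ q) π Xⱼ Dⱼ _ ⟩
        form (ιφ q) Xⱼ (λ s → X s k + π * D s k) + π * form (ιφ q) Dⱼ (λ s → X s k + π * D s k)
          ≈⟨ +-cong (form-affineʳ (ιφ q) Xⱼ π Xₖ Dₖ) (*-congˡ (form-affineʳ (ιφ q) Dⱼ π Xₖ Dₖ)) ⟩
        (form (ιφ q) Xⱼ Xₖ + π * form (ιφ q) Xⱼ Dₖ) + π * (Γ j k + π * E)
          ≈⟨ +-congʳ (+-cong
               (trans (form-cong (λ r s → ι-φ (q r s)) (λ _ → refl) (λ _ → refl))
                      (form-affineᴹ π (ιq⁽p⁾ q) (ιδ q) Xⱼ Xₖ))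
               -- Symmetry of `q` turns the cross term with `D` on the right into `Γ k j`.
               (*-congˡ (trans (form-transpose (ιφ q) Xⱼ Dₖ)
                               (form-cong φq-sym (λ _ → refl) (λ _ → refl))))) ⟩
        (Q₀ + π * Q₁ + π * Γ k j) + π * (Γ j k + π * E)  ∎

      π*-cancelled : Q₁ + (Γ j k + Γ k j + π * E) ≈ d
      π*-cancelled = TorsionFree-cancel A tf _ d (begin
        π * (Q₁ + (Γ j k + Γ k j + π * E))
          -- `Q₀` is added and subtracted to complete the left side to the expanded metric equation.
          ≈⟨ xyx⁻¹≈y Q₀ _ ⟨
        Q₀ + π * (Q₁ + (Γ j k + Γ k j + π * E)) - Q₀
          ≈⟨ +-congʳ (solve 6 (λ π q₀ q₁ g g′ e →
               q₀ :+ π :* (q₁ :+ (g :+ g′ :+ π :* e))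
                 := (q₀ :+ π :* q₁ :+ π :* g′) :+ π :* (g :+ π :* e))
               refl π Q₀ Q₁ (Γ j k) (Γ k j) E) ⟩
        (Q₀ + π * Q₁ + π * Γ k j) + π * (Γ j k + π * E) - Q₀
          ≈⟨ +-congʳ (trans (sym expand) (metric-equation metric j k)) ⟩
        ((x ᵗ · ιM q · x) ⁽ p ⁾) j k - Q₀
          ≈⟨ p*defect δ𝒪 pr q j k ⟨
        d * π  ≈⟨ *-comm d π ⟩
        π * d  ∎)

      eq : - (π * E) ≈ (Γ j k + Γ k j) - (- Q₁ + d)
      eq = sym (begin
        (Γ j k + Γ k j) - (- Q₁ + d)
          ≈⟨ +-congˡ (-‿cong (+-congˡ π*-cancelled)) ⟨
        G - (- Q₁ + (Q₁ + (G + π * E)))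
          ≈⟨ +-congˡ (-‿cong (trans (sym (+-assoc _ _ _)) (trans (+-congʳ (-‿inverseˡ Q₁)) (+-identityˡ _)))) ⟩
        G - (G + π * E)          ≈⟨ +-congˡ (⁻¹-∙-comm G (π * E)) ⟨
        G + (- G - π * E)        ≈⟨ +-assoc _ _ _ ⟨
        (G - G) - π * E          ≈⟨ trans (+-congʳ (-‿inverseʳ G)) (+-identityˡ _) ⟩
        - (π * E)                ∎)
        where G = Γ j k + Γ k j

  -- Reduction modulo (p, x-1)

  private
    module J = CommutativeRing (quotientRing A p,x-1)

  x-1∈ : ∀ j k → x j k J.≈ 𝟙 j k
  x-1∈ j k = generator (inj₂ (j , k))

  -- By `⁽p⁾-ᵗ··`, p times the defect lies in p J. Unscaling yields an element of J with the same
  -- p-multiple, and torsion-freeness identifies it with the defect.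
  defect∈ : ∀ q j k → Ideal p,x-1 (defect δ𝒪 pr q j k)
  defect∈ q j k =
    let y , y∈ , πy≈ = Ideal-unscale A π (⁽p⁾-ᵗ·· A pr p,x-1 x∈ (ιM q) j k)
    in resp-≈ (TorsionFree-cancel A tf y _
         (trans πy≈ (trans (sym (p*defect δ𝒪 pr q j k)) (*-comm _ π)))) y∈
    where
    x∈ : ∀ r s → r ≢ s → Ideal p,x-1 (x r s)
    x∈ r s r≢s = Ideal-resp-∼ A (x-1∈ r s) (resp-≈ (sym (𝟙-off-diagonal r≢s)) 0∈)

  -- Modulo J the matrix x⁽ᵖ⁾ becomes the identity and the defect vanishes.
  C≡-δq : ∀ q i j k → C-matrix δ𝒪 pr q i j k ≡ - ιδ (q i) j k [mod⟨ p,x-1 ⟩]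
  C≡-δq q i j k = J.trans
    (J.+-cong
      (J.-‿cong (J.trans
        (BilinearForm.form-cong (quotientRing A p,x-1) {Q = ιδ (q i)} {Q′ = ιδ (q i)}
          {column X j} {column 𝟙 j} {column X k} {column 𝟙 k}
          (λ _ _ → J.refl) (λ r → X≡𝟙 r j) (λ s → X≡𝟙 s k))
        (≈⇒∼ A p,x-1 (form-𝟙 (ιδ (q i)) j k))))
      (resp-≈ (sym (trans (+-congˡ -0#≈0#) (+-identityʳ _))) (defect∈ (q i) j k)))
    (J.+-identityʳ _)
    where
    X≡𝟙 : ∀ r s → X r s ≡ 𝟙 r s [mod⟨ p,x-1 ⟩]
    X≡𝟙 r s = J.trans (mod-^ A p,x-1 p (x-1∈ r s))
      (≈⇒∼ A p,x-1 (𝟙-⁽⁾ p {{prime⇒nonZero pr}} r s))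

  -- The two congruences for the Levi-Civita connection

  module _ (q : Fin n → Arith.Matrix 𝒪 n) (q-sym : ∀ i → Arith.IsSymmetric 𝒪 (q i))
      (∇ : Fin n → PAdicConnection δ𝒪) (levi-civita : IsLeviCivita δ𝒪 q ∇)
      {h : O.Carrier} (h*2 : h O.* Arith.num 𝒪 2 O.≈ O.1#) where
    private
      open IsLeviCivita levi-civita
      Γ  = Christoffel δ𝒪 q ∇
      C  = C-matrix δ𝒪 pr q
      δq = λ i j k → ι (δ𝒪.δ (q i j k))

      ιh*2 : ι h * num 2 ≈ 1#
      ιh*2 = begin
        ι h * num 2              ≈⟨ *-congˡ (Hom.num-homo 𝒪 A ι-hom 2) ⟨
        ι h * ι (Arith.num 𝒪 2)  ≈⟨ ι.*-homo _ _ ⟨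
        ι (h O.* Arith.num 𝒪 2)  ≈⟨ ι.⟦⟧-cong h*2 ⟩
        ι O.1#                   ≈⟨ ι.1#-homo ⟩
        1#                       ∎

    -- Koszul's formula in A/p, where Γ i j k + Γ i k j equals C i j k and the image of `h` inverts
    -- 2.
    christoffel-mod-p : ∀ i j k → Γ i j k ≡ ι h * (C i j k + C j i k - C k i j) [mod π ]
    christoffel-mod-p i j k = Ideal-principal A
      (koszul (quotientRing A (principal A π)) Γ C
        (λ i j k → Ideal-∣ A tt (christoffel-+-transpose (q i) (∇ i) (q-sym i) (isMetric i) j k))
        (λ i j k → ≈⇒∼ A (principal A π) (symmetric i j k))
        (≈⇒∼ A (principal A π) ιh*2) i j k)

    -- As p lies in J, the first congruence persists modulo J, where every C is replaced by -δq.
    christoffel-mod-p,x-1 : ∀ i j k →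
      Γ i j k ≡ - (ι h * (δq i j k + δq j i k - δq k i j)) [mod⟨ p,x-1 ⟩]
    christoffel-mod-p,x-1 i j k = J.trans
      (Ideal-∣ A (inj₁ tt) (christoffel-mod-p i j k))
      (J.trans
        (J.*-congˡ (J.+-cong (J.+-cong (C≡-δq q i j k) (C≡-δq q j i k)) (J.-‿cong (C≡-δq q k i j))))
        (≈⇒∼ A p,x-1 (begin
          ι h * (- δq i j k - δq j i k - - δq k i j)
            ≈⟨ *-congˡ (trans (+-congʳ (⁻¹-∙-comm _ _)) (⁻¹-∙-comm _ _)) ⟩
          ι h * - (δq i j k + δq j i k - δq k i j)
            ≈⟨ -‿distribʳ-* _ _ ⟨
          - (ι h * (δq i j k + δq j i k - δq k i j))  ∎)))

-- The ring 𝒪(Ĝ)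

module _ (𝒪 : CommutativeRing c ℓ) (p n : ℕ) where
  open GL 𝒪 p n
  private
    𝒪[x] = Polynomial.ring[] 𝒪 (n ℕ.* n)

    toFraction-hom : IsRingHom 𝒪 𝒪[x,det⁻¹] _
    toFraction-hom = IsRingHom-∘ 𝒪 𝒪[x] 𝒪[x,det⁻¹]
      (toLocalization-isRingHom 𝒪[x] det-x) (const-isRingHom 𝒪 (n ℕ.* n))

  ι-isRingHom : IsRingHom 𝒪 𝒪Ĝ ι
  ι-isRingHom = IsRingHom-∘ 𝒪 𝒪[x,det⁻¹] 𝒪Ĝ
    (toCompletion-isRingHom 𝒪[x,det⁻¹] (Arith.num 𝒪[x,det⁻¹] p)) toFraction-hom

  -- Torsion-freeness passes through polynomials, fractions and completion in turn. It is obtained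
  -- for images of p under the structure maps, which `num-homo` identifies with the numeral p of the
  -- target ring.
  𝒪Ĝ-torsionFree : TorsionFree 𝒪 (Arith.num 𝒪 p) → TorsionFree 𝒪Ĝ (Arith.num 𝒪Ĝ p)
  𝒪Ĝ-torsionFree tf = TorsionFree-resp 𝒪Ĝ
    (completion-torsionFree 𝒪[x,det⁻¹] _
      (TorsionFree-resp 𝒪[x,det⁻¹]
        (localization-torsionFree 𝒪[x] det-x (const-torsionFree 𝒪 (n ℕ.* n) tf))
        (Homomorphism.num-homo 𝒪 𝒪[x,det⁻¹] toFraction-hom p)))
    (Homomorphism.num-homo 𝒪[x,det⁻¹] 𝒪Ĝ
      (toCompletion-isRingHom 𝒪[x,det⁻¹] (Arith.num 𝒪[x,det⁻¹] p)) p)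

IsDVRWithUniformizer⇒torsionFree : (R : CommutativeRing c ℓ) {π : CommutativeRing.Carrier R} →
  IsDVRWithUniformizer R π → TorsionFree R π
IsDVRWithUniformizer⇒torsionFree R dvr x πx≈0 with IsDVRWithUniformizer.noZeroDivisors dvr πx≈0
... | inj₁ π≈0 = contradiction π≈0 (IsDVRWithUniformizer.π≉0 dvr)
... | inj₂ x≈0 = x≈0

proposition2p19 :
    ∀ {c ℓ} (p : ℕ) (pr : Prime p) (odd : ¬ (2 ∣ p))
      (𝒪 : CommutativeRing c ℓ) (base : IsCompleteDVRPerfectResidue 𝒪 p) (δ𝒪 : PDerivation 𝒪 p)
      (n : ℕ) → 1 ≤ n →
      (q : Fin n → Arith.Matrix 𝒪 n) →
      (∀ i → Arith.IsSymmetric 𝒪 (q i)) →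
      (∀ i → Arith.IsInvertible 𝒪 (q i)) →
      let open GL 𝒪 p n
          open Connections 𝒪 𝒪Ĝ ι p x in
      (∇ : Fin n → PAdicConnection δ𝒪) → IsLeviCivita δ𝒪 q ∇ →
      let open CommutativeRing 𝒪Ĝ
          open Arith 𝒪Ĝ
          open PDerivation δ𝒪 using (δ)
          ½Ĝ = ι (½ 𝒪 odd (IsCompleteDVRPerfectResidue.isDVR base))
          Γ  = Christoffel δ𝒪 q ∇
          C  = C-matrix δ𝒪 pr q
          δq = λ i j k → ι (δ (q i j k)) in
      ∀ i j k →
        (Γ i j k ≡ ½Ĝ * (C i j k + C j i k - C k i j) [mod num p ])
        ×
        (Γ i j k ≡ - (½Ĝ * (δq i j k + δq j i k - δq k i j)) [mod⟨ p,x-1 ⟩])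
proposition2p19 p pr odd 𝒪 base δ𝒪 n _ q q-sym _ ∇ levi-civita i j k =
  christoffel-mod-p 𝒪 𝒪Ĝ ι-hom pr tf x δ𝒪 q q-sym ∇ levi-civita ½*2 i j k ,
  christoffel-mod-p,x-1 𝒪 𝒪Ĝ ι-hom pr tf x δ𝒪 q q-sym ∇ levi-civita ½*2 i j k
  where
  open GL 𝒪 p n
  open IsCompleteDVRPerfectResidue base
  ι-hom = ι-isRingHom 𝒪 p n
  tf    = 𝒪Ĝ-torsionFree 𝒪 p n (IsDVRWithUniformizer⇒torsionFree 𝒪 isDVR)
  -- Oddness of p enters here, by making 2 a unit of 𝒪.
  ½*2   = proj₂ (half 𝒪 odd isDVR)
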